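{- For all integers $L\ge 1$, $$G\left(L-1,L+1,5,\tfrac{5}{2},6,q\right)\geq0.$$
   Context: $\mathbf N$ denotes the set of nonnegative integers. For $m\in\mathbf N$, $(q)_m=\prod_{j=1}^m(1-q^j)$, with $(q)_0=1$. The $q$-binomial coefficient is $\begin{bmatrix} m+n\\ m\end{bmatrix}_q=\frac{(q)_{m+n}}{(q)_m(q)_n}$ if $m,n\in\mathbf N$, and it is $0$ otherwise (so $\begin{bmatrix} A\\ B\end{bmatrix}_q=0$ unless $0\le B\le A$). Define $$G(N,M,\alpha,\beta,K,q)=\sum_{j=-\infty}^\infty(-1)^j q^{Kj\frac{(\alpha+\beta)j+(\alpha-\beta)}{2}}\begin{bmatrix} N+M\\ N-Kj\end{bmatrix}_q .$$ The notation $P(q)\ge 0$ means that $P(q)$ is a polynomial in $q$ with nonnegative coefficients. -}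

module Defs where

open import Data.Bool.Base using (if_then_else_)
open import Data.Empty using (⊥-elim)
open import Data.Fin.Base using (Fin; zero; suc; toℕ)
open import Data.Integer.Base as ℤ
  using (ℤ; +_; -[1+_]; 0ℤ; 1ℤ; -1ℤ; ∣_∣)
import Data.Integer.Properties as ℤ
open import Data.Integer.Tactic.RingSolver using (solve-∀)
open import Data.Nat.Base as ℕ using (ℕ; zero; suc; NonZero)
import Data.Nat.Properties as ℕ
open import Data.Product.Base using (∃-syntax; _×_)
open import Data.Rational.Base as ℚ using (ℚ; mkℚ; ½; _/_)
open import Data.Vec.Functional using (Vector; _∷_)
open import Relation.Binary.PropositionalEquality
open import Algebra.Properties.CommutativeMonoid.Sum ℤ.+-0-commutativeMonoid
  using (sum-syntax; sum⁺-syntax; sum-cong-≗)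

-- Formal power series ℤ[[q]], given by their coefficients.
Series : Set
Series = ℕ → ℤ

𝟘 : Series
𝟘 _ = 0ℤ

q^_ : ℕ → Series
(q^ k) n = if k ℕ.≡ᵇ n then 1ℤ else 0ℤ

infixl 6 _⊝_
infixl 7 _⊛_ _⊘_

_⊝_ : Series → Series → Series
(f ⊝ g) n = f n ℤ.- g n

_⊛_ : Series → Series → Series
(f ⊛ g) n = ∑[ i ≤ n ] (f (n ℕ.∸ toℕ i) ℤ.* g (toℕ i))

-- The first n coefficients of f / g, highest first, by long division; this
-- is only meaningful when g has constant term 1 (see ⊘-⊛).
quotients : Series → Series → (n : ℕ) → Vector ℤ n
quotients f g zero    = λ ()
quotients f g (suc n) =
  (f n ℤ.- ∑[ i < n ] (quotients f g n i ℤ.* g (suc (toℕ i)))) ∷ quotients f g n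

_⊘_ : Series → Series → Series
(f ⊘ g) n = quotients f g (suc n) zero

quotients-⊘ : ∀ f g n (i : Fin (suc n)) →
              quotients f g (suc n) i ≡ (f ⊘ g) (n ℕ.∸ toℕ i)
quotients-⊘ f g n       zero    = refl
quotients-⊘ f g (suc n) (suc i) = quotients-⊘ f g n i

⊘-⊛ : ∀ f g → g 0 ≡ 1ℤ → f ⊘ g ⊛ g ≗ f
⊘-⊛ f g g₀ n = begin
  (f ⊘ g) n ℤ.* g 0 ℤ.+ t
    ≡⟨ cong (λ x → (f ⊘ g) n ℤ.* x ℤ.+ t) g₀ ⟩
  (f ⊘ g) n ℤ.* 1ℤ ℤ.+ t
    ≡⟨ cong₂ ℤ._+_ (ℤ.*-identityʳ ((f ⊘ g) n)) (sum-cong-≗ {n} (tail-eq n)) ⟩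
  (f n ℤ.- s) ℤ.+ s
    ≡⟨ cancel (f n) s ⟩
  f n ∎
  where
  open ≡-Reasoning
  t = ∑[ i < n ] ((f ⊘ g) (n ℕ.∸ suc (toℕ i)) ℤ.* g (suc (toℕ i)))
  s = ∑[ i < n ] (quotients f g n i ℤ.* g (suc (toℕ i)))
  cancel : ∀ a b → (a ℤ.- b) ℤ.+ b ≡ a
  cancel = solve-∀
  tail-eq : ∀ n (i : Fin n) →
            (f ⊘ g) (n ℕ.∸ suc (toℕ i)) ℤ.* g (suc (toℕ i)) ≡
            quotients f g n i ℤ.* g (suc (toℕ i))
  tail-eq (suc n) i =
    cong (ℤ._* g (suc (toℕ i))) (sym (quotients-⊘ f g n i))

⟨q⟩_ : ℕ → Series
⟨q⟩ zero  = q^ 0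
⟨q⟩ suc m = (⟨q⟩ m) ⊛ (q^ 0 ⊝ q^ suc m)

-- q-binomial coefficient [m + n, m].
gauss : ℤ → ℤ → Series
gauss (+ m) (+ n) = (⟨q⟩ (m ℕ.+ n)) ⊘ ((⟨q⟩ m) ⊛ (⟨q⟩ n))
gauss _     _     = 𝟘

-- q-binomial coefficient [A, B].
qbinom : ℤ → ℤ → Series
qbinom A B = gauss B (A ℤ.- B)

⟨q⟩-const : ∀ m → (⟨q⟩ m) 0 ≡ 1ℤ
⟨q⟩-const zero    = refl
⟨q⟩-const (suc m) rewrite ⟨q⟩-const m = refl

gauss-⊛ : ∀ m n → gauss (+ m) (+ n) ⊛ ((⟨q⟩ m) ⊛ (⟨q⟩ n)) ≗ ⟨q⟩ (m ℕ.+ n)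
gauss-⊛ m n = ⊘-⊛ (⟨q⟩ (m ℕ.+ n)) ((⟨q⟩ m) ⊛ (⟨q⟩ n)) const
  where
  const : ((⟨q⟩ m) ⊛ (⟨q⟩ n)) 0 ≡ 1ℤ
  const rewrite ⟨q⟩-const m | ⟨q⟩-const n = refl

-- Since α and β are rational, so are the exponents of q in G a priori.  A
-- formal sum of rational powers of q is given by the coefficient of each q^r.
QSeries : Set
QSeries = ℚ → ℤ

fromSeries : Series → QSeries
fromSeries f (mkℚ (+ n) zero _) = f n
fromSeries f _                  = 0ℤ

q^_·_ : ℚ → QSeries → QSeries
(q^ e · P) r = P (r ℚ.- e)

fromℤ : ℤ → ℚ
fromℤ i = i / 1

exponent : ℚ → ℚ → ℕ → ℤ → ℚ
exponent α β K j =
  fromℤ (+ K) ℚ.* fromℤ j ℚ.* ((α ℚ.+ β) ℚ.* fromℤ j ℚ.+ (α ℚ.- β)) ℚ.* ½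

summand : ℤ → ℤ → ℚ → ℚ → ℕ → ℤ → QSeries
summand N M α β K j r =
  -1ℤ ℤ.^ ∣ j ∣ ℤ.*
  (q^ exponent α β K j · fromSeries (qbinom (N ℤ.+ M) (N ℤ.- + K ℤ.* j))) r

-- Sum of t j over -B ≤ j ≤ B.
sumℤ : ℕ → (ℤ → ℤ) → ℤ
sumℤ B t = t 0ℤ ℤ.+ ∑[ i < B ] (t (+ suc (toℕ i)) ℤ.+ t -[1+ toℕ i ])

-- The sum over all j ∈ ℤ; the summands left out are zero by summand-vanishes.
G : (N M : ℤ) (α β : ℚ) (K : ℕ) .{{_ : NonZero K}} → QSeries
G N M α β K r = sumℤ (∣ N ∣ ℕ.+ ∣ M ∣) (λ j → summand N M α β K j r)

infix 4 _≥0

_≥0 : QSeries → Set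
P ≥0 = (∃[ d ] ∀ r → P r ≢ 0ℤ → ∃[ n ] n ℕ.≤ d × r ≡ fromℤ (+ n))
     × (∀ r → 0ℤ ℤ.≤ P r)

gauss-negˡ : ∀ m n → m ℤ.< 0ℤ → gauss m n ≗ 𝟘
gauss-negˡ -[1+ _ ] _ _ _ = refl
gauss-negˡ (+ _) _ (ℤ.+<+ ())

gauss-negʳ : ∀ m n → n ℤ.< 0ℤ → gauss m n ≗ 𝟘
gauss-negʳ (+ _)    -[1+ _ ] _ _ = refl
gauss-negʳ -[1+ _ ] -[1+ _ ] _ _ = refl
gauss-negʳ _ (+ _) (ℤ.+<+ ())

fromSeries-𝟘 : ∀ {f} → f ≗ 𝟘 → ∀ r → fromSeries f r ≡ 0ℤ
fromSeries-𝟘 f≗𝟘 (mkℚ (+ n)    zero    _) = f≗𝟘 n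
fromSeries-𝟘 f≗𝟘 (mkℚ (+ n)    (suc _) _) = refl
fromSeries-𝟘 f≗𝟘 (mkℚ -[1+ n ] _       _) = refl

i≤+∣i∣ : ∀ i → i ℤ.≤ + ∣ i ∣
i≤+∣i∣ (+ n)    = ℤ.≤-refl
i≤+∣i∣ -[1+ n ] = ℤ.-≤+

private
  diff<0 : ∀ X K k .{{_ : NonZero K}} → ∣ X ∣ ℕ.< k →
           X ℤ.- + K ℤ.* + k ℤ.< 0ℤ
  diff<0 X K k X<k = subst (X ℤ.- + K ℤ.* + k ℤ.<_) (ℤ.+-inverseʳ (+ K ℤ.* + k))
    (ℤ.+-monoˡ-< (ℤ.- (+ K ℤ.* + k))
      (ℤ.≤-<-trans (i≤+∣i∣ X)
        (subst (+ ∣ X ∣ ℤ.<_) (ℤ.pos-* K k)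
          (ℤ.+<+ (ℕ.<-≤-trans X<k (ℕ.m≤n*m k K))))))

  complement : ∀ N M K k →
    M ℤ.- K ℤ.* k ≡ N ℤ.+ M ℤ.- (N ℤ.- K ℤ.* (ℤ.- k))
  complement = solve-∀

qbinom-vanishes : ∀ N M K .{{_ : NonZero K}} j → ∣ N ∣ ℕ.+ ∣ M ∣ ℕ.< ∣ j ∣ →
                  qbinom (N ℤ.+ M) (N ℤ.- + K ℤ.* j) ≗ 𝟘
qbinom-vanishes N M K (+ k) lt =
  gauss-negˡ _ (N ℤ.+ M ℤ.- (N ℤ.- + K ℤ.* + k))
    (diff<0 N K k (ℕ.≤-<-trans (ℕ.m≤m+n ∣ N ∣ ∣ M ∣) lt))
qbinom-vanishes N M K -[1+ k ] lt =
  gauss-negʳ (N ℤ.- + K ℤ.* -[1+ k ]) _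
    (subst (ℤ._< 0ℤ) (complement N M (+ K) (+ suc k))
      (diff<0 M K (suc k) (ℕ.≤-<-trans (ℕ.m≤n+m ∣ M ∣ ∣ N ∣) lt)))

summand-vanishes : ∀ N M α β K .{{_ : NonZero K}} j → ∣ N ∣ ℕ.+ ∣ M ∣ ℕ.< ∣ j ∣ →
                   ∀ r → summand N M α β K j r ≡ 0ℤ
summand-vanishes N M α β K j lt r =
  trans (cong (-1ℤ ℤ.^ ∣ j ∣ ℤ.*_)
          (fromSeries-𝟘 (qbinom-vanishes N M K j lt) (r ℚ.- exponent α β K j)))
        (ℤ.*-zeroʳ (-1ℤ ℤ.^ ∣ j ∣))

{-# OPTIONS --safe #-}

-- Write L for the given integer, tri m = m(m+1)/2, [n, k] for the q-binomial
-- coefficient, and χ(0), χ(1), … = 1, 0, -1, -1, 0, 1, … (of period 6).  Putting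
-- 2m + 1 = |6j + 1|, the alternating sum is Σ_m χ(m) q^{5 tri m} [2L, L+1+2m].
-- The q-Vandermonde formula gives
--   q^{m²+m} [2L, L+1+2m] = Σ_i q^{i²+i} [L, i-m] [L, i+m+1],
-- and, combined with a rearrangement of q-multinomial coefficients, also
--   q^{m²+m} [L, i-m] [L, i+m+1]
--     = Σ_s q^{s²+s} [L, 2s+1] [L-2s-1, i-s] [2s+1, s+1+m].
-- Both kernels have nonnegative coefficients, so what remains is the positivity of
--   Σ_m χ(m) q^{tri m} [2s+1, s+1+m] = Π_{i=1}^s (1 + q^i + q^{2i}).
-- This product formula is the part of the finite Jacobi triple product whose
-- z-exponents are divisible by 3; the proof is by induction on s, as χ is an
-- eigenvector of the resulting three-term recurrence.

module Submission where

open import Defs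
open import Algebra.Bundles using (CommutativeRing)
import Algebra.Construct.Pointwise as Pointwise
open import Data.Bool.Base using (true; false)
open import Data.Fin.Base using (Fin; toℕ)
import Data.Fin.Properties as Fin
open import Data.Integer.Base as ℤ using (ℤ; +_; -[1+_]; 0ℤ; 1ℤ; -1ℤ)
import Data.Integer.Properties as ℤ
import Data.Integer.Tactic.RingSolver as ℤ-Solver
open import Data.Nat.Base as ℕ using (ℕ; zero; suc; _∸_; s≤s; z≤n; s<s)
import Data.Nat.Coprimality as Coprime
import Data.Nat.Properties as ℕ
import Data.Nat.Tactic.RingSolver as ℕ-Solver
open import Data.Product.Base using (_,_; ∃-syntax; _×_)
open import Data.Rational.Base as ℚ using (ℚ; mkℚ; ½; _/_; toℚᵘ)
import Data.Rational.Properties as ℚ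
import Data.Rational.Solver as ℚ-Solver
open import Data.Rational.Unnormalised.Base as ℚᵘ using (mkℚᵘ; *≡*)
import Data.Rational.Unnormalised.Properties as ℚᵘ
open import Data.Sum.Base using (_⊎_; inj₁; inj₂)
open import Function.Base using (_∘_)
open import Relation.Binary.PropositionalEquality as ≡ using (_≡_; _≢_; _≗_)
open import Relation.Nullary using (yes; no)
open import Relation.Nullary.Negation using (contradiction)
import Algebra.Properties.CommutativeMonoid.Sum ℤ.+-0-commutativeMonoid as ℤ-Sum

-- q-binomial identities in a commutative ring

tri : ℕ → ℕ
tri zero    = 0
tri (suc m) = suc m ℕ.+ tri m

tri+tri : ∀ m → tri m ℕ.+ tri m ≡ m ℕ.* suc m
tri+tri zero    = ≡.refl
tri+tri (suc m) = ≡.trans (lemma m (tri m)) (≡.trans (≡.cong (2 ℕ.* suc m ℕ.+_) (tri+tri m)) (lemma₂ m))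
  where
  lemma : ∀ m t → suc m ℕ.+ t ℕ.+ (suc m ℕ.+ t) ≡ 2 ℕ.* suc m ℕ.+ (t ℕ.+ t)
  lemma = ℕ-Solver.solve-∀
  lemma₂ : ∀ m → 2 ℕ.* suc m ℕ.+ m ℕ.* suc m ≡ suc m ℕ.* suc (suc m)
  lemma₂ = ℕ-Solver.solve-∀

-- Only the exponent laws of the powers of q enter these identities, so each `x^ k` can be an opaque
-- atom for the ring solver. Power series are substituted afterwards.
module QBinomial
  {r ℓ} (R : CommutativeRing r ℓ)
  (x^_ : ℕ → CommutativeRing.Carrier R)
  (x^-zero : CommutativeRing._≈_ R (x^ 0) (CommutativeRing.1# R))
  (x^-+ : ∀ m n → CommutativeRing._≈_ R (x^ (m ℕ.+ n)) (CommutativeRing._*_ R (x^ m) (x^ n)))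
  where

  open CommutativeRing R
  open import Algebra.Properties.Semiring.Sum semiring
  open import Algebra.Solver.Ring.NaturalCoefficients.Default commutativeSemiring
    using (solve; _:+_; _:*_; _:=_; con)
  open import Relation.Binary.Reasoning.Setoid setoid

  -- Finite sums over initial segments of the natural numbers.

  ∑< : ℕ → (ℕ → Carrier) → Carrier
  ∑< n f = ∑[ i < n ] f (toℕ i)

  ∑<-cong : ∀ n {f g} → (∀ i → i ℕ.< n → f i ≈ g i) → ∑< n f ≈ ∑< n g
  ∑<-cong n eq = sum-cong-≋ (λ i → eq (toℕ i) (Fin.toℕ<n i))

  ∑<-zero : ∀ n {f} → (∀ i → i ℕ.< n → f i ≈ 0#) → ∑< n f ≈ 0#
  ∑<-zero n eq = trans (∑<-cong n eq) (sum-replicate-zero n)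

  ∑<-last : ∀ n f → ∑< (suc n) f ≈ ∑< n f + f n
  ∑<-last zero    f = +-comm _ _
  ∑<-last (suc n) f = trans (+-congˡ (∑<-last n (f ∘ suc))) (sym (+-assoc _ _ _))

  ∑<-split : ∀ m n f → ∑< (m ℕ.+ n) f ≈ ∑< m f + ∑< n (f ∘ (m ℕ.+_))
  ∑<-split zero    n f = sym (+-identityˡ _)
  ∑<-split (suc m) n f = trans (+-congˡ (∑<-split m n (f ∘ suc))) (sym (+-assoc _ _ _))

  ∑<-+ : ∀ n f g → ∑< n (λ i → f i + g i) ≈ ∑< n f + ∑< n g
  ∑<-+ n f g = ∑-distrib-+ {n} (f ∘ toℕ) (g ∘ toℕ)

  ∑<-* : ∀ n y f → ∑< n (λ i → y * f i) ≈ y * ∑< n f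
  ∑<-* n y f = sym (*-distribˡ-sum {n} y (f ∘ toℕ))

  ∑<-swap : ∀ m n (f : ℕ → ℕ → Carrier) →
            ∑< m (λ i → ∑< n (f i)) ≈ ∑< n (λ j → ∑< m (λ i → f i j))
  ∑<-swap m n f = ∑-comm {m} {n} (λ i j → f (toℕ i) (toℕ j))

  -- Gaussian binomials: the two Pascal rules and q-Vandermonde.

  x^-cong : ∀ {m n} → m ≡ n → x^ m ≈ x^ n
  x^-cong eq = reflexive (≡.cong x^_ eq)

  -- The Gaussian binomial [n, k], given by a q-Pascal rule instead of a quotient: no division is
  -- involved, the value for k > n is 0, and positivity can be read off from the recurrence.
  C : ℕ → ℕ → Carrier
  C _       zero    = 1#
  C zero    (suc k) = 0#
  C (suc n) (suc k) = C n k + x^ suc k * C n (suc k)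

  C-cong : ∀ {m n k l} → m ≡ n → k ≡ l → C m k ≈ C n l
  C-cong eq eq′ = reflexive (≡.cong₂ C eq eq′)

  C-congˡ : ∀ {m n} k → m ≡ n → C m k ≈ C n k
  C-congˡ k eq = C-cong eq (≡.refl {x = k})

  C-congʳ : ∀ {k l} n → k ≡ l → C n k ≈ C n l
  C-congʳ n eq = C-cong (≡.refl {x = n}) eq

  C-vanish : ∀ {n k} → n ℕ.< k → C n k ≈ 0#
  C-vanish {zero}  {suc k} _         = refl
  C-vanish {suc n} {suc k} (s≤s n<k) = begin
    C n k + x^ suc k * C n (suc k)  ≈⟨ +-cong (C-vanish n<k) (*-congˡ (C-vanish (ℕ.m<n⇒m<1+n n<k))) ⟩
    0# + x^ suc k * 0#              ≈⟨ trans (+-identityˡ _) (zeroʳ _) ⟩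
    0#                              ∎

  C-diag : ∀ n → C n n ≈ 1#
  C-diag zero    = refl
  C-diag (suc n) = begin
    C n n + x^ suc n * C n (suc n)  ≈⟨ +-cong (C-diag n) (*-congˡ (C-vanish (ℕ.n<1+n n))) ⟩
    1# + x^ suc n * 0#              ≈⟨ trans (+-congˡ (zeroʳ _)) (+-identityʳ _) ⟩
    1#                              ∎

  -- C n k vanishes when the truncated subtraction n ∸ k is not exact.
  x^-∸ : ∀ n k e e′ → (k ℕ.≤ n → e ℕ.+ (n ∸ k) ≡ e′) →
         x^ e * (x^ (n ∸ k) * C n k) ≈ x^ e′ * C n k
  x^-∸ n k e e′ eq with k ℕ.≤? n
  ... | yes k≤n = trans (sym (*-assoc _ _ _))
                        (*-congʳ (trans (sym (x^-+ e (n ∸ k))) (x^-cong (eq k≤n))))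
  ... | no  k≰n = begin
    x^ e * (x^ (n ∸ k) * C n k)  ≈⟨ *-congˡ (*-congˡ n<k) ⟩
    x^ e * (x^ (n ∸ k) * 0#)     ≈⟨ trans (*-congˡ (zeroʳ _)) (zeroʳ _) ⟩
    0#                           ≈⟨ zeroʳ _ ⟨
    x^ e′ * 0#                   ≈⟨ *-congˡ n<k ⟨
    x^ e′ * C n k                ∎
    where n<k = C-vanish (ℕ.≰⇒> k≰n)

  -- The mirror image of the defining rule. Both terms of that rule are expanded by induction, and
  -- the middle terms recombine because (k + 2) + (n - k - 1) = (n - k) + (k + 1).
  C-pascal : ∀ n k → C (suc n) (suc k) ≈ x^ (n ∸ k) * C n k + C n (suc k)
  C-pascal zero    zero    = begin
    1# + x^ 1 * 0#   ≈⟨ +-congˡ (zeroʳ _) ⟩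
    1# + 0#          ≈⟨ +-congʳ (trans (*-congʳ x^-zero) (*-identityˡ _)) ⟨
    x^ 0 * 1# + 0#   ∎
  C-pascal zero    (suc k) = begin
    0# + x^ suc (suc k) * 0#   ≈⟨ trans (+-congˡ (zeroʳ _)) (sym (+-congʳ (zeroʳ _))) ⟩
    x^ 0 * 0# + 0#             ∎
  C-pascal (suc n) zero    = begin
    1# + x^ 1 * C (suc n) 1
      ≈⟨ +-congˡ (*-congˡ (C-pascal n 0)) ⟩
    1# + x^ 1 * (x^ n * 1# + C n 1)
      ≈⟨ solve 3 (λ a b d → con 1 :+ a :* (b :* con 1 :+ d) := (a :* b) :* con 1 :+ (con 1 :+ a :* d)) refl
           (x^ 1) (x^ n) (C n 1) ⟩
    (x^ 1 * x^ n) * 1# + (1# + x^ 1 * C n 1)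
      ≈⟨ +-congʳ (*-congʳ (x^-+ 1 n)) ⟨
    x^ suc n * 1# + (1# + x^ 1 * C n 1)
      ∎
  C-pascal (suc n) (suc k) = begin
    C (suc n) (suc k) + x^ suc (suc k) * C (suc n) (suc (suc k))
      ≈⟨ +-cong (C-pascal n k) (*-congˡ (C-pascal n (suc k))) ⟩
    (x^ (n ∸ k) * C n k + C n (suc k)) +
      x^ suc (suc k) * (x^ (n ∸ suc k) * C n (suc k) + C n (suc (suc k)))
      ≈⟨ +-congˡ (distribˡ _ _ _) ⟩
    (x^ (n ∸ k) * C n k + C n (suc k)) +
      (x^ suc (suc k) * (x^ (n ∸ suc k) * C n (suc k)) + x^ suc (suc k) * C n (suc (suc k)))
      ≈⟨ +-congˡ (+-congʳ (trans (x^-∸ n (suc k) _ (n ∸ k ℕ.+ suc k) exps) (*-congʳ (x^-+ _ _)))) ⟩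
    (x^ (n ∸ k) * C n k + C n (suc k)) +
      (x^ (n ∸ k) * x^ suc k * C n (suc k) + x^ suc (suc k) * C n (suc (suc k)))
      ≈⟨ solve 5 (λ a b d e f → (a :* b :+ d) :+ (a :* e :* d :+ f) := a :* (b :+ e :* d) :+ (d :+ f)) refl
           (x^ (n ∸ k)) (C n k) (C n (suc k)) (x^ suc k) (x^ suc (suc k) * C n (suc (suc k))) ⟩
    x^ (n ∸ k) * (C n k + x^ suc k * C n (suc k)) +
      (C n (suc k) + x^ suc (suc k) * C n (suc (suc k)))
      ∎
    where
    exps : suc k ℕ.≤ n → suc (suc k) ℕ.+ (n ∸ suc k) ≡ n ∸ k ℕ.+ suc k
    exps k<n with ℕ.m≤n⇒∃[o]m+o≡n k<n
    ... | o , ≡.refl = ≡.trans (≡.cong (suc (suc k) ℕ.+_) (ℕ.m+n∸m≡n (suc k) o))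
                      (≡.trans (ℕ.+-comm (suc (suc k)) o)
                      (≡.trans (ℕ.+-suc o (suc k))
                               (≡.cong (ℕ._+ suc k) (≡.sym n∸k))))
      where
      n∸k : suc k ℕ.+ o ∸ k ≡ suc o
      n∸k = ≡.trans (≡.cong (_∸ k) (≡.sym (ℕ.+-suc k o))) (ℕ.m+n∸m≡n k (suc o))

  -- Induction on a with c varying: `C-pascal` applied to [a + 1, t + 1] splits the sum into the
  -- sums for (a, c) and (a, c + 1), which are the two terms of the defining rule on the left. Any
  -- bound N > a will do, since the terms with t > a vanish.
  vandermonde : ∀ a b c N → a ℕ.< N →
    C (a ℕ.+ b) (a ℕ.+ c) ≈ ∑< N (λ t → x^ (t ℕ.* (t ℕ.+ c)) * (C a t * C b (t ℕ.+ c)))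
  vandermonde zero b c (suc N) _ = begin
    C b c
      ≈⟨ trans (*-identityˡ _) (*-identityˡ _) ⟨
    1# * (1# * C b c)
      ≈⟨ trans (+-identityʳ _) (*-congʳ x^-zero) ⟨
    x^ 0 * (1# * C b c) + 0#
      ≈⟨ +-congˡ (∑<-zero N (λ t _ →
           trans (*-congˡ {x^ (suc t ℕ.* (suc t ℕ.+ c))} (zeroˡ (C b (suc t ℕ.+ c)))) (zeroʳ _))) ⟨
    x^ 0 * (1# * C b c) +
      ∑< N (λ t → x^ (suc t ℕ.* (suc t ℕ.+ c)) * (0# * C b (suc t ℕ.+ c)))
      ∎
  vandermonde (suc a) b c (suc N) (s≤s a<N) = sym (begin
    v (suc a) c 0 + ∑< N (λ t → v (suc a) c (suc t))
      ≈⟨ +-congˡ (∑<-cong N (λ t _ → step t)) ⟩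
    v a c 0 + ∑< N (λ t → v a c (suc t) + x^ suc (a ℕ.+ c) * v a (suc c) t)
      ≈⟨ +-congˡ (trans (∑<-+ N (v a c ∘ suc) (λ t → x^ suc (a ℕ.+ c) * v a (suc c) t))
                        (+-congˡ (∑<-* N _ (v a (suc c))))) ⟩
    v a c 0 + (∑< N (λ t → v a c (suc t)) + x^ suc (a ℕ.+ c) * ∑< N (v a (suc c)))
      ≈⟨ +-assoc _ _ _ ⟨
    ∑< (suc N) (v a c) + x^ suc (a ℕ.+ c) * ∑< N (v a (suc c))
      ≈⟨ +-cong (vandermonde a b c (suc N) (ℕ.m<n⇒m<1+n a<N)) (*-congˡ (vandermonde a b (suc c) N a<N)) ⟨
    C (a ℕ.+ b) (a ℕ.+ c) + x^ suc (a ℕ.+ c) * C (a ℕ.+ b) (a ℕ.+ suc c)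
      ≈⟨ +-congˡ (*-congˡ (C-congʳ _ (ℕ.+-suc a c))) ⟩
    C (a ℕ.+ b) (a ℕ.+ c) + x^ suc (a ℕ.+ c) * C (a ℕ.+ b) (suc (a ℕ.+ c))
      ∎)
    where
    v : ℕ → ℕ → ℕ → Carrier
    v a c t = x^ (t ℕ.* (t ℕ.+ c)) * (C a t * C b (t ℕ.+ c))

    exps : ∀ t → t ℕ.≤ a →
           suc t ℕ.* (suc t ℕ.+ c) ℕ.+ (a ∸ t) ≡ suc (a ℕ.+ c) ℕ.+ t ℕ.* (t ℕ.+ suc c)
    exps t t≤a with ℕ.m≤n⇒∃[o]m+o≡n t≤a
    ... | o , ≡.refl rewrite ℕ.m+n∸m≡n t o = lemma t o c
      where
      lemma : ∀ t o c → suc t ℕ.* (suc t ℕ.+ c) ℕ.+ o ≡ suc (t ℕ.+ o ℕ.+ c) ℕ.+ t ℕ.* (t ℕ.+ suc c)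
      lemma = ℕ-Solver.solve-∀

    step : ∀ t → v (suc a) c (suc t) ≈ v a c (suc t) + x^ suc (a ℕ.+ c) * v a (suc c) t
    step t = begin
      X * (C (suc a) (suc t) * Y)
        ≈⟨ *-congˡ (*-congʳ (C-pascal a t)) ⟩
      X * ((x^ (a ∸ t) * C a t + C a (suc t)) * Y)
        ≈⟨ solve 5 (λ X Y Z A B → X :* ((Z :* A :+ B) :* Y) := X :* (B :* Y) :+ X :* (Z :* A) :* Y) refl
             X Y (x^ (a ∸ t)) (C a t) (C a (suc t)) ⟩
      X * (C a (suc t) * Y) + X * (x^ (a ∸ t) * C a t) * Y
        ≈⟨ +-congˡ (*-congʳ (trans (x^-∸ a t _ _ (exps t)) (*-congʳ (x^-+ (suc (a ℕ.+ c)) _)))) ⟩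
      X * (C a (suc t) * Y) + x^ suc (a ℕ.+ c) * x^ (t ℕ.* (t ℕ.+ suc c)) * C a t * Y
        ≈⟨ +-congˡ (trans (*-congˡ (C-congʳ _ (≡.sym (ℕ.+-suc t c))))
             (solve 4 (λ a b c d → a :* b :* c :* d := a :* (b :* (c :* d))) refl _ _ _ _)) ⟩
      X * (C a (suc t) * Y) + x^ suc (a ℕ.+ c) * v a (suc c) t
        ∎
      where
      X = x^ (suc t ℕ.* (suc t ℕ.+ c))
      Y = C b (suc t ℕ.+ c)

  -- q-factorials and q-multinomial coefficients.

  fac : ℕ → Carrier
  fac zero    = 1#
  fac (suc m) = fac m * (1# - x^ suc m)

  private
    complement : ∀ y → (1# - y) + y ≈ 1#
    complement y = trans (+-assoc _ _ _) (trans (+-congˡ (-‿inverseˡ y)) (+-identityʳ 1#))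

    complement-* : ∀ y z → (1# - y) + y * (1# - z) ≈ 1# - y * z
    -- The solver works in commutative semirings. Adding `y * z` to both sides lets `1# - y` and
    -- `1# - z` act as atoms that `complement` completes to 1.
    complement-* y z = +-cancelʳ (y * z) _ _ (begin
      (1# - y) + y * (1# - z) + y * z
        ≈⟨ solve 4 (λ a b c d → a :+ b :* c :+ b :* d := a :+ b :* (c :+ d)) refl _ _ _ _ ⟩
      (1# - y) + y * ((1# - z) + z)
        ≈⟨ +-congˡ (trans (*-congˡ (complement z)) (*-identityʳ y)) ⟩
      (1# - y) + y
        ≈⟨ trans (complement y) (sym (complement (y * z))) ⟩
      1# - y * z + y * z
        ∎)
      where open import Algebra.Properties.Ring ring using (+-cancelʳ)

  -- The defining rule splits the left side into two instances with sum m + n smaller by one; they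
  -- recombine through (1 - X) + X (1 - Y) = 1 - X Y, with X and Y the powers m + 1 and n + 1.
  C-fac : ∀ m n → C (m ℕ.+ n) m * (fac m * fac n) ≈ fac (m ℕ.+ n)
  C-fac zero    n    = trans (*-identityˡ _) (*-identityˡ _)
  C-fac (suc m) zero = begin
    C (suc m ℕ.+ 0) (suc m) * (fac (suc m) * 1#)
      ≈⟨ *-cong (trans (C-congˡ (suc m) (ℕ.+-identityʳ (suc m))) (C-diag (suc m))) (*-identityʳ _) ⟩
    1# * fac (suc m)
      ≈⟨ *-identityˡ _ ⟩
    fac (suc m)
      ≡⟨ ≡.cong fac (ℕ.+-identityʳ (suc m)) ⟨
    fac (suc m ℕ.+ 0)
      ∎
  C-fac (suc m) (suc n) = begin
    (C k m + X * C k (suc m)) * ((fac m * U) * (fac n * V))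
      ≈⟨ solve 7 (λ a X b f U g V → (a :+ X :* b) :* ((f :* U) :* (g :* V)) :=
                   (a :* (f :* (g :* V))) :* U :+ X :* (b :* ((f :* U) :* g)) :* V)
               refl (C k m) X (C k (suc m)) (fac m) U (fac n) V ⟩
    (C k m * (fac m * fac (suc n))) * U + X * (C k (suc m) * (fac (suc m) * fac n)) * V
      ≈⟨ +-cong (*-congʳ (C-fac m (suc n))) (*-congʳ (*-congˡ C-fac′)) ⟩
    fac k * U + X * fac k * V
      ≈⟨ solve 4 (λ f U X V → f :* U :+ X :* f :* V := f :* (U :+ X :* V)) refl (fac k) U X V ⟩
    fac k * (U + X * V)
      ≈⟨ *-congˡ (complement-* X (x^ suc n)) ⟩
    fac k * (1# - X * x^ suc n)
      ≈⟨ *-congˡ (+-congˡ (-‿cong (x^-+ (suc m) (suc n)))) ⟨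
    fac (suc k)
      ∎
    where
    k = m ℕ.+ suc n
    X = x^ suc m
    U = 1# - X
    V = 1# - x^ suc n

    C-fac′ : C k (suc m) * (fac (suc m) * fac n) ≈ fac k
    C-fac′ = ≡.subst (λ k → C k (suc m) * (fac (suc m) * fac n) ≈ fac k)
                     (≡.sym (ℕ.+-suc m n)) (C-fac (suc m) n)

  -- For power series this holds because each `fac m` has constant term 1. It makes `C-fac`
  -- determine the q-binomials, so that identities can be checked after clearing denominators.
  module Cancellative
    (cancel : ∀ m {y z} → y * fac m ≈ z * fac m → y ≈ z)
    where

    cancel₂ : ∀ m n {y z} → y * (fac m * fac n) ≈ z * (fac m * fac n) → y ≈ z
    cancel₂ m n eq = cancel m (cancel n (trans (*-assoc _ _ _) (trans eq (sym (*-assoc _ _ _)))))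

    C-sym : ∀ m n {k} → m ℕ.+ n ≡ k → C k m ≈ C k n
    C-sym m n ≡.refl = cancel₂ m n (begin
      C (m ℕ.+ n) m * (fac m * fac n)  ≈⟨ C-fac m n ⟩
      fac (m ℕ.+ n)                    ≡⟨ ≡.cong fac (ℕ.+-comm m n) ⟩
      fac (n ℕ.+ m)                    ≈⟨ C-fac n m ⟨
      C (n ℕ.+ m) n * (fac n * fac m)  ≈⟨ *-cong (C-congˡ n (ℕ.+-comm n m)) (*-comm _ _) ⟩
      C (m ℕ.+ n) n * (fac m * fac n)  ∎)

    C-multinomial : ∀ i j k l →
      C (i ℕ.+ j ℕ.+ (k ℕ.+ l)) (i ℕ.+ j) * (C (i ℕ.+ j) i * C (k ℕ.+ l) k) *
        ((fac i * fac j) * (fac k * fac l)) ≈ fac (i ℕ.+ j ℕ.+ (k ℕ.+ l))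
    C-multinomial i j k l = begin
      X * (Y * Z) * ((fac i * fac j) * (fac k * fac l))
        ≈⟨ solve 5 (λ X Y Z f g → X :* (Y :* Z) :* (f :* g) := X :* ((Y :* f) :* (Z :* g))) refl
             X Y Z (fac i * fac j) (fac k * fac l) ⟩
      X * ((Y * (fac i * fac j)) * (Z * (fac k * fac l)))
        ≈⟨ *-congˡ (*-cong (C-fac i j) (C-fac k l)) ⟩
      X * (fac (i ℕ.+ j) * fac (k ℕ.+ l))
        ≈⟨ C-fac (i ℕ.+ j) (k ℕ.+ l) ⟩
      fac (i ℕ.+ j ℕ.+ (k ℕ.+ l))
        ∎
      where
      X = C (i ℕ.+ j ℕ.+ (k ℕ.+ l)) (i ℕ.+ j)
      Y = C (i ℕ.+ j) i
      Z = C (k ℕ.+ l) k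

    -- Both sides are the q-multinomial coefficient with parts i, j, k, l; the parts are paired as
    -- (i, j), (k, l) on the left and as (i, k), (j, l) on the right.
    C-interchange : ∀ i j k l →
      C (i ℕ.+ j ℕ.+ (k ℕ.+ l)) (i ℕ.+ j) * (C (i ℕ.+ j) i * C (k ℕ.+ l) k) ≈
      C (i ℕ.+ k ℕ.+ (j ℕ.+ l)) (i ℕ.+ k) * (C (i ℕ.+ k) i * C (j ℕ.+ l) j)
    C-interchange i j k l = cancel₂ i j (cancel₂ k l (begin
      Y * (fac i * fac j) * (fac k * fac l)
        ≈⟨ trans (*-assoc _ _ _) (C-multinomial i j k l) ⟩
      fac (i ℕ.+ j ℕ.+ (k ℕ.+ l))
        ≡⟨ ≡.cong fac (parts i j k l) ⟩
      fac (i ℕ.+ k ℕ.+ (j ℕ.+ l))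
        ≈⟨ C-multinomial i k j l ⟨
      Z * ((fac i * fac k) * (fac j * fac l))
        ≈⟨ solve 5 (λ a f g h k → a :* ((f :* h) :* (g :* k)) := a :* (f :* g) :* (h :* k)) refl
             Z (fac i) (fac j) (fac k) (fac l) ⟩
      Z * (fac i * fac j) * (fac k * fac l)
        ∎))
      where
      Y = C (i ℕ.+ j ℕ.+ (k ℕ.+ l)) (i ℕ.+ j) * (C (i ℕ.+ j) i * C (k ℕ.+ l) k)
      Z = C (i ℕ.+ k ℕ.+ (j ℕ.+ l)) (i ℕ.+ k) * (C (i ℕ.+ k) i * C (j ℕ.+ l) j)

      parts : ∀ i j k l → i ℕ.+ j ℕ.+ (k ℕ.+ l) ≡ i ℕ.+ k ℕ.+ (j ℕ.+ l)
      parts = ℕ-Solver.solve-∀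

    -- shift f i m is f (i - m), or 0 when i < m.
    shift : (ℕ → Carrier) → ℕ → ℕ → Carrier
    shift f i       zero    = f i
    shift f zero    (suc m) = 0#
    shift f (suc i) (suc m) = shift f i m

    shift-< : ∀ f {i m} → i ℕ.< m → shift f i m ≈ 0#
    shift-< f {zero}  {suc m} _         = refl
    shift-< f {suc i} {suc m} (s≤s i<m) = shift-< f i<m

    shift-+ : ∀ f m t → shift f (m ℕ.+ t) m ≡ f t
    shift-+ f zero    t = ≡.refl
    shift-+ f (suc m) t = shift-+ f m t

    -- First expansion: central q-binomials.

    private
      shift-exps : ∀ m t → (m ℕ.+ t) ℕ.* suc (m ℕ.+ t) ≡ m ℕ.* suc m ℕ.+ t ℕ.* (t ℕ.+ suc (m ℕ.+ m))
      shift-exps = ℕ-Solver.solve-∀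

      shift-top : ∀ m t → m ℕ.+ t ℕ.+ suc m ≡ t ℕ.+ suc (m ℕ.+ m)
      shift-top = ℕ-Solver.solve-∀

    -- This is q-Vandermonde with a = b = L and c = 2m + 1, reindexed by i = m + t. The exponents
    -- agree since i(i + 1) = m(m + 1) + t(t + 2m + 1).
    C-central : ∀ L m N → m ℕ.+ L ℕ.< N →
      x^ (m ℕ.* suc m) * C (L ℕ.+ L) (L ℕ.+ suc (m ℕ.+ m)) ≈
      ∑< N (λ i → x^ (i ℕ.* suc i) * (shift (C L) i m * C L (i ℕ.+ suc m)))
    C-central L m N m+L<N with ℕ.m≤n⇒∃[o]m+o≡n m+L<N
    ... | o , ≡.refl = sym (begin
      ∑< N f
        ≡⟨ ≡.cong (λ N → ∑< N f) (range m L o) ⟩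
      ∑< (m ℕ.+ N′) f
        ≈⟨ ∑<-split m N′ f ⟩
      ∑< m f + ∑< N′ (f ∘ (m ℕ.+_))
        ≈⟨ +-cong (∑<-zero m {f} (λ i i<m →
                    trans (*-congˡ (trans (*-congʳ (shift-< (C L) i<m)) (zeroˡ _))) (zeroʳ _)))
                  (∑<-cong N′ (λ t _ → step t)) ⟩
      0# + ∑< N′ (λ t → x^ (m ℕ.* suc m) * g t)
        ≈⟨ trans (+-identityˡ _) (∑<-* N′ _ g) ⟩
      x^ (m ℕ.* suc m) * ∑< N′ g
        ≈⟨ *-congˡ (vandermonde L L (suc (m ℕ.+ m)) N′ (ℕ.m≤m+n (suc L) o)) ⟨
      x^ (m ℕ.* suc m) * C (L ℕ.+ L) (L ℕ.+ suc (m ℕ.+ m))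
        ∎)
      where
      N′ = suc L ℕ.+ o
      f g : ℕ → Carrier
      f i = x^ (i ℕ.* suc i) * (shift (C L) i m * C L (i ℕ.+ suc m))
      g t = x^ (t ℕ.* (t ℕ.+ suc (m ℕ.+ m))) * (C L t * C L (t ℕ.+ suc (m ℕ.+ m)))

      range : ∀ m L o → suc (m ℕ.+ L ℕ.+ o) ≡ m ℕ.+ (suc L ℕ.+ o)
      range = ℕ-Solver.solve-∀

      step : ∀ t → f (m ℕ.+ t) ≈ x^ (m ℕ.* suc m) * g t
      step t = trans (*-cong (trans (x^-cong (shift-exps m t)) (x^-+ (m ℕ.* suc m) _))
                             (*-cong (reflexive (shift-+ (C L) m t)) (C-congʳ _ (shift-top m t))))
                     (*-assoc _ _ _)

    -- Second expansion: linearizing a product of two q-binomials.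

    weight : ℕ → ℕ → ℕ → Carrier
    weight L i s = x^ (s ℕ.* suc s) * (C L (suc (s ℕ.+ s)) * C (L ∸ suc (s ℕ.+ s)) (i ∸ s))

    weight-vanish₀ : ∀ L i s → L ℕ.< suc (s ℕ.+ s) → weight L i s ≈ 0#
    weight-vanish₀ L i s lt = trans (*-congˡ (trans (*-congʳ (C-vanish lt)) (zeroˡ _))) (zeroʳ _)

    -- For L = 2s + 1 + r and i = s + n the hypothesis says r < n, so [r, n] = 0. For smaller L the
    -- factor [L, 2s + 1] is already 0.
    weight-vanish : ∀ L i s → s ℕ.≤ i → L ℕ.≤ i ℕ.+ s → weight L i s ≈ 0#
    weight-vanish L i s s≤i L≤i+s with suc (s ℕ.+ s) ℕ.≤? L
    ... | no  ≰ = weight-vanish₀ L i s (ℕ.≰⇒> ≰)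
    ... | yes ≤ with ℕ.m≤n⇒∃[o]m+o≡n s≤i | ℕ.m≤n⇒∃[o]m+o≡n ≤
    ...   | n , ≡.refl | r , ≡.refl =
      trans (*-congˡ (trans (*-congˡ (C-vanish r<n)) (zeroʳ _))) (zeroʳ _)
      where
      swap : ∀ s n → s ℕ.+ n ℕ.+ s ≡ s ℕ.+ s ℕ.+ n
      swap = ℕ-Solver.solve-∀

      r<n : suc (s ℕ.+ s) ℕ.+ r ∸ suc (s ℕ.+ s) ℕ.< s ℕ.+ n ∸ s
      r<n = ≡.subst₂ ℕ._<_ (≡.sym (ℕ.m+n∸m≡n (suc (s ℕ.+ s)) r)) (≡.sym (ℕ.m+n∸m≡n s n))
        (ℕ.+-cancelˡ-< (s ℕ.+ s) r n (≡.subst (s ℕ.+ s ℕ.+ r ℕ.<_) (swap s n) L≤i+s))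

    -- Put i = m + a, c = 2m + 1 and L = a + b + c. Then [L, a] = [L, b + c] is a q-Vandermonde sum
    -- of terms [b, t] [a + c, t + c]. Multiplied by [L, a + c], each term is a q-multinomial
    -- coefficient with parts t + c, a - t, t, b - t, and pairing the parts differently gives the
    -- summand s = m + t. The variable m survives only in the last q-binomial, which is why `weight`
    -- is free of it.
    C-linearize : ∀ L m i →
      x^ (m ℕ.* suc m) * (shift (C L) i m * C L (i ℕ.+ suc m)) ≈
      ∑< (suc i) (λ s → weight L i s * C (suc (s ℕ.+ s)) (suc (s ℕ.+ m)))
    C-linearize L m i with m ℕ.≤? i
    ... | no m≰i = begin
      x^ (m ℕ.* suc m) * (shift (C L) i m * C L (i ℕ.+ suc m))
        ≈⟨ trans (*-congˡ (trans (*-congʳ (shift-< (C L) i<m)) (zeroˡ _))) (zeroʳ _) ⟩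
      0#
        ≈⟨ ∑<-zero (suc i) (λ s s≤i → trans (*-congˡ {weight L i s}
              (C-vanish (s<s (ℕ.+-monoʳ-< s (ℕ.≤-<-trans (ℕ.≤-pred s≤i) i<m))))) (zeroʳ _)) ⟨
      ∑< (suc i) (λ s → weight L i s * C (suc (s ℕ.+ s)) (suc (s ℕ.+ m)))
        ∎
      where i<m = ℕ.≰⇒> m≰i
    ... | yes m≤i with ℕ.m≤n⇒∃[o]m+o≡n m≤i | i ℕ.+ suc m ℕ.≤? L
    ...   | a , ≡.refl | no ≰ = begin
      x^ (m ℕ.* suc m) * (shift (C L) i m * C L (i ℕ.+ suc m))
        ≈⟨ trans (*-congˡ (trans (*-congˡ (C-vanish (ℕ.≰⇒> ≰))) (zeroʳ _))) (zeroʳ _) ⟩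
      0#
        ≈⟨ ∑<-zero (suc i) {λ s → weight L i s * C (suc (s ℕ.+ s)) (suc (s ℕ.+ m))} vanish ⟨
      ∑< (suc i) (λ s → weight L i s * C (suc (s ℕ.+ s)) (suc (s ℕ.+ m)))
        ∎
      where
      -- Here L ≤ i + m. A summand with s < m vanishes through its last q-binomial, one with s ≥ m
      -- through its weight, as L ≤ i + s.
      vanish : ∀ s → s ℕ.< suc i → weight L i s * C (suc (s ℕ.+ s)) (suc (s ℕ.+ m)) ≈ 0#
      vanish s (s≤s s≤i) with m ℕ.≤? s
      ... | no  m≰s = trans (*-congˡ (C-vanish (s<s (ℕ.+-monoʳ-< s (ℕ.≰⇒> m≰s))))) (zeroʳ _)
      ... | yes m≤s = trans (*-congʳ (weight-vanish L i s s≤i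
        (ℕ.≤-trans (ℕ.≤-pred (≡.subst (L ℕ.<_) (ℕ.+-suc i m) (ℕ.≰⇒> ≰))) (ℕ.+-monoʳ-≤ i m≤s)))) (zeroˡ _)
    ...   | a , ≡.refl | yes ≤ with ℕ.m≤n⇒∃[o]m+o≡n ≤
    ...     | b , ≡.refl = begin
      x^ (m ℕ.* suc m) * (shift (C L) i m * C L (i ℕ.+ suc m))
        ≈⟨ *-congˡ (*-cong (trans (reflexive (shift-+ (C L) m a)) C-L-a) (C-congʳ _ (shift-top m a))) ⟩
      x^ (m ℕ.* suc m) * (∑< (suc a) f * C L (a ℕ.+ c))
        ≈⟨ solve 3 (λ x y z → x :* (y :* z) := x :* z :* y) refl _ _ _ ⟩
      x^ (m ℕ.* suc m) * C L (a ℕ.+ c) * ∑< (suc a) f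
        ≈⟨ ∑<-* (suc a) _ f ⟨
      ∑< (suc a) (λ t → x^ (m ℕ.* suc m) * C L (a ℕ.+ c) * f t)
        ≈⟨ ∑<-cong (suc a) {λ t → x^ (m ℕ.* suc m) * C L (a ℕ.+ c) * f t} {g ∘ (m ℕ.+_)}
             (λ t t<a → step t (ℕ.≤-pred t<a)) ⟩
      ∑< (suc a) (g ∘ (m ℕ.+_))
        ≈⟨ +-identityˡ _ ⟨
      0# + ∑< (suc a) (g ∘ (m ℕ.+_))
        ≈⟨ +-congʳ (∑<-zero m {g} (λ s s<m →
             trans (*-congˡ (C-vanish (s<s (ℕ.+-monoʳ-< s s<m)))) (zeroʳ _))) ⟨
      ∑< m g + ∑< (suc a) (g ∘ (m ℕ.+_))
        ≈⟨ ∑<-split m (suc a) g ⟨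
      ∑< (m ℕ.+ suc a) g
        ≡⟨ ≡.cong (λ N → ∑< N g) (ℕ.+-suc m a) ⟩
      ∑< (suc i) g
        ∎
      where
      c = suc (m ℕ.+ m)
      f g : ℕ → Carrier
      f t = x^ (t ℕ.* (t ℕ.+ c)) * (C b t * C (a ℕ.+ c) (t ℕ.+ c))
      g s = weight L i s * C (suc (s ℕ.+ s)) (suc (s ℕ.+ m))

      L≡₁ : ∀ m a b → a ℕ.+ (b ℕ.+ suc (m ℕ.+ m)) ≡ m ℕ.+ a ℕ.+ suc m ℕ.+ b
      L≡₁ = ℕ-Solver.solve-∀

      L≡₂ : ∀ m a b → m ℕ.+ a ℕ.+ suc m ℕ.+ b ≡ b ℕ.+ (a ℕ.+ suc (m ℕ.+ m))
      L≡₂ = ℕ-Solver.solve-∀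

      C-L-a : C L a ≈ ∑< (suc a) f
      C-L-a = begin
        C L a
          ≈⟨ C-sym a (b ℕ.+ c) (L≡₁ m a b) ⟩
        C L (b ℕ.+ c)
          ≈⟨ C-congˡ (b ℕ.+ c) (L≡₂ m a b) ⟩
        C (b ℕ.+ (a ℕ.+ c)) (b ℕ.+ c)
          ≈⟨ vandermonde b (a ℕ.+ c) c (suc a ℕ.+ b) (s≤s (ℕ.m≤n+m b a)) ⟩
        ∑< (suc a ℕ.+ b) f
          ≈⟨ ∑<-split (suc a) b f ⟩
        ∑< (suc a) f + ∑< b (f ∘ (suc a ℕ.+_))
          ≈⟨ +-congˡ (∑<-zero b {f ∘ (suc a ℕ.+_)} (λ t _ →
               trans (*-congˡ (trans (*-congˡ (C-vanish (ℕ.+-monoˡ-< c (s≤s (ℕ.m≤m+n a t))))) (zeroʳ _))) (zeroʳ _))) ⟩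
        ∑< (suc a) f + 0#
          ≈⟨ +-identityʳ _ ⟩
        ∑< (suc a) f
          ∎

      step : ∀ t → t ℕ.≤ a → x^ (m ℕ.* suc m) * C L (a ℕ.+ c) * f t ≈ g (m ℕ.+ t)
      step t t≤a with t ℕ.≤? b
      -- Here [b, t] = 0 on the left, while on the right L = i + m + 1 + b ≤ i + (m + t) makes the
      -- weight vanish.
      ... | no t≰b = begin
        x^ (m ℕ.* suc m) * C L (a ℕ.+ c) * f t
          ≈⟨ trans (*-congˡ (trans (*-congˡ (trans (*-congʳ (C-vanish b<t)) (zeroˡ _))) (zeroʳ _))) (zeroʳ _) ⟩
        0#
          ≈⟨ trans (*-congʳ (weight-vanish L i (m ℕ.+ t) (ℕ.+-monoʳ-≤ m t≤a) L≤)) (zeroˡ _) ⟨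
        g (m ℕ.+ t)
          ∎
        where
        b<t = ℕ.≰⇒> t≰b
        regroup₁ : ∀ m a b → m ℕ.+ a ℕ.+ m ℕ.+ suc b ≡ m ℕ.+ a ℕ.+ suc m ℕ.+ b
        regroup₁ = ℕ-Solver.solve-∀
        L≤ : L ℕ.≤ i ℕ.+ (m ℕ.+ t)
        L≤ = ≡.subst₂ ℕ._≤_ (regroup₁ m a b) (ℕ.+-assoc i m t) (ℕ.+-monoʳ-≤ (m ℕ.+ a ℕ.+ m) b<t)
      ... | yes t≤b with ℕ.m≤n⇒∃[o]m+o≡n t≤a | ℕ.m≤n⇒∃[o]m+o≡n t≤b
      ...   | n , ≡.refl | p , ≡.refl = begin
        x^ (m ℕ.* suc m) * C L (a ℕ.+ c) * (x^ (t ℕ.* (t ℕ.+ c)) * (C b t * C (a ℕ.+ c) (t ℕ.+ c)))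
          ≈⟨ solve 5 (λ x y z u v → x :* y :* (z :* (u :* v)) := x :* z :* (y :* (v :* u))) refl _ _ _ _ _ ⟩
        x^ (m ℕ.* suc m) * x^ (t ℕ.* (t ℕ.+ c)) * (C L (a ℕ.+ c) * (C (a ℕ.+ c) (t ℕ.+ c) * C b t))
          ≈⟨ *-cong (trans (sym (x^-+ (m ℕ.* suc m) _)) (x^-cong (≡.sym (shift-exps m t))))
                    (*-cong (C-cong (e₁ m t n p) (e₂ m t n)) (*-congʳ (C-congˡ (t ℕ.+ c) (e₂ m t n)))) ⟩
        x^ (s ℕ.* suc s) * (C (t ℕ.+ c ℕ.+ n ℕ.+ (t ℕ.+ p)) (t ℕ.+ c ℕ.+ n) *
                            (C (t ℕ.+ c ℕ.+ n) (t ℕ.+ c) * C (t ℕ.+ p) t))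
          -- The pairs change from (t + c, n), (t, p) to (t + c, t), (n, p), where a = t + n and b =
          -- t + p. Then 2t + c = 2s + 1 and n + p = L - 2s - 1.
          ≈⟨ *-congˡ (C-interchange (t ℕ.+ c) n t p) ⟩
        x^ (s ℕ.* suc s) * (C (t ℕ.+ c ℕ.+ t ℕ.+ (n ℕ.+ p)) (t ℕ.+ c ℕ.+ t) *
                            (C (t ℕ.+ c ℕ.+ t) (t ℕ.+ c) * C (n ℕ.+ p) n))
          ≈⟨ *-congˡ (*-cong (C-cong (e₃ m t n p) (e₄ m t))
               (*-cong (C-cong (e₄ m t) (e₅ m t)) (C-cong (≡.sym L∸) (≡.sym i∸)))) ⟩
        x^ (s ℕ.* suc s) * (C L (suc (s ℕ.+ s)) *
                            (C (suc (s ℕ.+ s)) (suc (s ℕ.+ m)) * C (L ∸ suc (s ℕ.+ s)) (i ∸ s)))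
          ≈⟨ solve 4 (λ x y z u → x :* (y :* (z :* u)) := x :* (y :* u) :* z) refl _ _ _ _ ⟩
        g s
          ∎
        where
        s = m ℕ.+ t
        e₁ : ∀ m t n p → m ℕ.+ (t ℕ.+ n) ℕ.+ suc m ℕ.+ (t ℕ.+ p) ≡ t ℕ.+ suc (m ℕ.+ m) ℕ.+ n ℕ.+ (t ℕ.+ p)
        e₁ = ℕ-Solver.solve-∀
        e₂ : ∀ m t n → t ℕ.+ n ℕ.+ suc (m ℕ.+ m) ≡ t ℕ.+ suc (m ℕ.+ m) ℕ.+ n
        e₂ = ℕ-Solver.solve-∀
        e₃ : ∀ m t n p → t ℕ.+ suc (m ℕ.+ m) ℕ.+ t ℕ.+ (n ℕ.+ p) ≡ m ℕ.+ (t ℕ.+ n) ℕ.+ suc m ℕ.+ (t ℕ.+ p)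
        e₃ = ℕ-Solver.solve-∀
        e₄ : ∀ m t → t ℕ.+ suc (m ℕ.+ m) ℕ.+ t ≡ suc (m ℕ.+ t ℕ.+ (m ℕ.+ t))
        e₄ = ℕ-Solver.solve-∀
        e₅ : ∀ m t → t ℕ.+ suc (m ℕ.+ m) ≡ suc (m ℕ.+ t ℕ.+ m)
        e₅ = ℕ-Solver.solve-∀
        e₆ : ∀ m t n p → m ℕ.+ (t ℕ.+ n) ℕ.+ suc m ℕ.+ (t ℕ.+ p) ≡ suc (m ℕ.+ t ℕ.+ (m ℕ.+ t)) ℕ.+ (n ℕ.+ p)
        e₆ = ℕ-Solver.solve-∀
        L∸ : L ∸ suc (s ℕ.+ s) ≡ n ℕ.+ p
        L∸ = ≡.trans (≡.cong (_∸ suc (s ℕ.+ s)) (e₆ m t n p)) (ℕ.m+n∸m≡n (suc (s ℕ.+ s)) (n ℕ.+ p))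
        i∸ : i ∸ s ≡ n
        i∸ = ≡.trans (≡.cong (_∸ s) (≡.sym (ℕ.+-assoc m t n))) (ℕ.m+n∸m≡n s n)

    -- The product formula for the χ-weighted sum.

    χ : ℕ → Carrier
    χ zero          = 1#
    χ (suc zero)    = 0#
    χ (suc (suc m)) = χ (suc m) - χ m

    χ-+ : ∀ m → χ (suc (suc m)) + χ m ≈ χ (suc m)
    χ-+ m = trans (+-assoc _ _ _) (trans (+-congˡ (-‿inverseˡ (χ m))) (+-identityʳ _))

    -- As χ (m - 1) + χ (m + 1) = χ m, with χ (-1) = χ 0 - χ 1 = 1, summation by
    -- parts moves the second difference to χ; f (-1) stands for f 0.
    ∑<-χ : ∀ (f : ℕ → Carrier) n →
      ∑< (suc n) (λ m → χ m * (f (m ∸ 1) + f (suc m))) + χ (suc n) * f n ≈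
      ∑< (suc n) (λ m → χ m * f m) + χ n * f (suc n)
    ∑<-χ f zero = solve 2 (λ y z → (con 1 :* (y :+ z) :+ con 0) :+ con 0 :* y :=
                                   (con 1 :* y :+ con 0) :+ con 1 :* z) refl (f 0) (f 1)
    ∑<-χ f (suc n) = begin
      ∑< (suc (suc n)) h + χ (suc (suc n)) * f (suc n)
        ≈⟨ +-congʳ (∑<-last (suc n) h) ⟩
      ∑< (suc n) h + χ (suc n) * (f n + f (suc (suc n))) + χ (suc (suc n)) * f (suc n)
        ≈⟨ solve 6 (λ s u v w y z → s :+ u :* (v :+ w) :+ y :* z := (s :+ u :* v) :+ (u :* w :+ y :* z)) refl
             (∑< (suc n) h) (χ (suc n)) (f n) (f (suc (suc n))) (χ (suc (suc n))) (f (suc n)) ⟩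
      (∑< (suc n) h + χ (suc n) * f n) + (χ (suc n) * f (suc (suc n)) + χ (suc (suc n)) * f (suc n))
        ≈⟨ +-congʳ (∑<-χ f n) ⟩
      (∑< (suc n) k + χ n * f (suc n)) + (χ (suc n) * f (suc (suc n)) + χ (suc (suc n)) * f (suc n))
        ≈⟨ solve 5 (λ s u v w y → (s :+ u :* v) :+ (w :+ y :* v) := (s :+ (y :+ u) :* v) :+ w) refl
             (∑< (suc n) k) (χ n) (f (suc n)) (χ (suc n) * f (suc (suc n))) (χ (suc (suc n))) ⟩
      (∑< (suc n) k + (χ (suc (suc n)) + χ n) * f (suc n)) + χ (suc n) * f (suc (suc n))
        ≈⟨ +-congʳ (+-congˡ (*-congʳ (χ-+ n))) ⟩
      (∑< (suc n) k + χ (suc n) * f (suc n)) + χ (suc n) * f (suc (suc n))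
        ≈⟨ +-congʳ (∑<-last (suc n) k) ⟨
      ∑< (suc (suc n)) k + χ (suc n) * f (suc (suc n))
        ∎
      where
      h k : ℕ → Carrier
      h m = χ m * (f (m ∸ 1) + f (suc m))
      k m = χ m * f m

    term : ℕ → ℕ → Carrier
    term s m = x^ tri m * C (suc (s ℕ.+ s)) (suc (s ℕ.+ m))

    term-vanish : ∀ {s m} → s ℕ.< m → term s m ≈ 0#
    term-vanish {s} s<m = trans (*-congˡ (C-vanish (s<s (ℕ.+-monoʳ-< s s<m)))) (zeroʳ _)

    -- One use of each Pascal rule lowers 2s + 3 to 2s + 1. The triangular exponents absorb the
    -- dependence on m: tri m + (s + 1 - m) = (s + 1) + tri (m - 1) and tri m + (s + m + 2) = (s +
    -- 1) + tri (m + 1), so both neighbours get the coefficient `x^ suc s`.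
    term-suc : ∀ s m → term (suc s) m ≈
      (1# + x^ (suc s ℕ.+ suc s)) * term s m + x^ suc s * (term s (m ∸ 1) + term s (suc m))
    term-suc s m = begin
      T * C (suc (suc s ℕ.+ suc s)) (suc (suc k))
        ≈⟨ *-congˡ (C-congˡ (suc (suc k)) (≡.cong (λ k → suc (suc k)) (ℕ.+-suc s s))) ⟩
      T * (C (suc n) (suc k) + x^ suc (suc k) * C (suc n) (suc (suc k)))
        ≈⟨ *-congˡ (+-cong (C-pascal n k) (trans (*-congˡ (C-pascal n (suc k))) (distribˡ _ _ _))) ⟩
      T * ((x^ (n ∸ k) * C n k + C n (suc k)) +
           (x^ suc (suc k) * (x^ (n ∸ suc k) * C n (suc k)) + x^ suc (suc k) * C n (suc (suc k))))
        ≈⟨ *-congˡ (+-congˡ (+-congʳ (x^-∸ n (suc k) _ _ exps))) ⟩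
      T * ((x^ (n ∸ k) * C n k + C n (suc k)) +
           (x^ (suc s ℕ.+ suc s) * C n (suc k) + x^ suc (suc k) * C n (suc (suc k))))
        ≈⟨ solve 7 (λ T x a b y z d → T :* ((x :* a :+ b) :+ (y :* b :+ z :* d)) :=
                     (con 1 :+ y) :* (T :* b) :+ (T :* (x :* a) :+ (T :* z) :* d)) refl
             T (x^ (n ∸ k)) (C n k) (C n (suc k)) (x^ (suc s ℕ.+ suc s)) (x^ suc (suc k)) (C n (suc (suc k))) ⟩
      (1# + x^ (suc s ℕ.+ suc s)) * term s m +
        (T * (x^ (n ∸ k) * C n k) + T * x^ suc (suc k) * C n (suc (suc k)))
        ≈⟨ +-congˡ (+-cong (left m) right) ⟩
      (1# + x^ (suc s ℕ.+ suc s)) * term s m + (x^ suc s * term s (m ∸ 1) + x^ suc s * term s (suc m))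
        ≈⟨ +-congˡ (distribˡ _ _ _) ⟨
      (1# + x^ (suc s ℕ.+ suc s)) * term s m + x^ suc s * (term s (m ∸ 1) + term s (suc m))
        ∎
      where
      n = suc (s ℕ.+ s)
      k = s ℕ.+ m
      T = x^ tri m

      exps : suc k ℕ.≤ n → suc (suc k) ℕ.+ (n ∸ suc k) ≡ suc s ℕ.+ suc s
      exps k<n = ≡.trans (≡.cong suc (ℕ.m+[n∸m]≡n k<n)) (≡.cong suc (≡.sym (ℕ.+-suc s s)))

      regroup : ∀ s m t → t ℕ.+ suc (suc (s ℕ.+ m)) ≡ suc s ℕ.+ (suc m ℕ.+ t)
      regroup = ℕ-Solver.solve-∀

      right : T * x^ suc (suc k) * C n (suc (suc k)) ≈ x^ suc s * term s (suc m)
      right = trans (*-cong (trans (sym (x^-+ (tri m) _)) (trans (x^-cong (regroup s m (tri m))) (x^-+ (suc s) _)))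
                            (C-congʳ n (≡.cong suc (≡.sym (ℕ.+-suc s m)))))
                    (*-assoc _ _ _)

      left : ∀ m → x^ tri m * (x^ (n ∸ (s ℕ.+ m)) * C n (s ℕ.+ m)) ≈ x^ suc s * term s (m ∸ 1)
      -- At m = 0 the neighbour -1 reflects to 0, because [2s + 1, s] = [2s + 1, s + 1]. This
      -- matches the truncated `0 ∸ 1`.
      left zero = begin
        x^ 0 * (x^ (n ∸ (s ℕ.+ 0)) * C n (s ℕ.+ 0))
          ≈⟨ x^-∸ n (s ℕ.+ 0) 0 (suc s) (λ _ → e₀) ⟩
        x^ suc s * C n (s ℕ.+ 0)
          ≈⟨ *-congˡ (C-sym (s ℕ.+ 0) (suc (s ℕ.+ 0)) e₁) ⟩
        x^ suc s * C n (suc (s ℕ.+ 0))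
          ≈⟨ *-congˡ (trans (*-congʳ x^-zero) (*-identityˡ _)) ⟨
        x^ suc s * (x^ 0 * C n (suc (s ℕ.+ 0)))
          ∎
        where
        e₀ : n ∸ (s ℕ.+ 0) ≡ suc s
        e₀ = ≡.trans (≡.cong₂ _∸_ (≡.sym (ℕ.+-suc s s)) (ℕ.+-identityʳ s)) (ℕ.m+n∸m≡n s (suc s))
        e₁ : s ℕ.+ 0 ℕ.+ suc (s ℕ.+ 0) ≡ n
        e₁ = ≡.trans (ℕ.+-suc _ _) (≡.cong suc (≡.cong₂ ℕ._+_ (ℕ.+-identityʳ s) (ℕ.+-identityʳ s)))
      left (suc m) = begin
        x^ tri (suc m) * (x^ (n ∸ (s ℕ.+ suc m)) * C n (s ℕ.+ suc m))
          ≈⟨ x^-∸ n (s ℕ.+ suc m) _ (suc s ℕ.+ tri m) e ⟩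
        x^ (suc s ℕ.+ tri m) * C n (s ℕ.+ suc m)
          ≈⟨ *-cong (x^-+ (suc s) (tri m)) (C-congʳ n (ℕ.+-suc s m)) ⟩
        x^ suc s * x^ tri m * C n (suc (s ℕ.+ m))
          ≈⟨ *-assoc _ _ _ ⟩
        x^ suc s * term s m
          ∎
        where
        e : s ℕ.+ suc m ℕ.≤ n → tri (suc m) ℕ.+ (n ∸ (s ℕ.+ suc m)) ≡ suc s ℕ.+ tri m
        e le with ℕ.m≤n⇒∃[o]m+o≡n le
        ... | o , eq = ≡.trans
          (≡.cong (tri (suc m) ℕ.+_)
            (≡.trans (≡.cong (_∸ (s ℕ.+ suc m)) (≡.sym eq)) (ℕ.m+n∸m≡n (s ℕ.+ suc m) o)))
          (ℕ.+-cancelˡ-≡ s _ _ (≡.trans (r₁ s m o (tri m)) (≡.trans (≡.cong (ℕ._+ tri m) eq) (r₂ s (tri m)))))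
          where
          r₁ : ∀ s m o t → s ℕ.+ (suc m ℕ.+ t ℕ.+ o) ≡ s ℕ.+ suc m ℕ.+ o ℕ.+ t
          r₁ = ℕ-Solver.solve-∀
          r₂ : ∀ s t → suc (s ℕ.+ s) ℕ.+ t ≡ s ℕ.+ (suc s ℕ.+ t)
          r₂ = ℕ-Solver.solve-∀

    prod : ℕ → Carrier
    prod zero    = 1#
    prod (suc s) = (1# + x^ suc s + x^ (suc s ℕ.+ suc s)) * prod s

    -- In `term-suc` summed against χ, `∑<-χ` replaces the sum over the neighbours by the original
    -- sum; its boundary terms vanish because n exceeds the previous s. Each step thus contributes
    -- one factor 1 + x^(s+1) + x^(2s+2).
    ∑<-χ-term : ∀ s n → s ℕ.≤ n → ∑< (suc n) (λ m → χ m * term s m) ≈ prod s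
    ∑<-χ-term zero n _ = begin
      1# * (x^ 0 * (1# + x^ 1 * 0#)) + ∑< n (λ m → χ (suc m) * term 0 (suc m))
        ≈⟨ +-cong (solve 2 (λ y z → con 1 :* (y :* (con 1 :+ z :* con 0)) := y) refl (x^ 0) (x^ 1))
                  (∑<-zero n {λ m → χ (suc m) * term 0 (suc m)}
                    (λ m _ → trans (*-congˡ (term-vanish {0} {suc m} (s≤s z≤n))) (zeroʳ _))) ⟩
      x^ 0 + 0#
        ≈⟨ trans (+-identityʳ _) x^-zero ⟩
      1#
        ∎
    ∑<-χ-term (suc s) n s<n = begin
      ∑< (suc n) (λ m → χ m * term (suc s) m)
        ≈⟨ ∑<-cong (suc n) {λ m → χ m * term (suc s) m} {λ m → X * f m + Y * g m}
             (λ m _ → trans (*-congˡ (term-suc s m))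
               (solve 5 (λ c X a Y b → c :* (X :* a :+ Y :* b) := X :* (c :* a) :+ Y :* (c :* b)) refl _ _ _ _ _)) ⟩
      ∑< (suc n) (λ m → X * f m + Y * g m)
        ≈⟨ ∑<-+ (suc n) (λ m → X * f m) (λ m → Y * g m) ⟩
      ∑< (suc n) (λ m → X * f m) + ∑< (suc n) (λ m → Y * g m)
        ≈⟨ +-cong (∑<-* (suc n) X f) (∑<-* (suc n) Y g) ⟩
      X * ∑< (suc n) f + Y * ∑< (suc n) g
        ≈⟨ +-congˡ (*-congˡ ∑g≈∑f) ⟩
      X * ∑< (suc n) f + Y * ∑< (suc n) f
        ≈⟨ solve 3 (λ z Y s → (con 1 :+ z) :* s :+ Y :* s := (con 1 :+ Y :+ z) :* s) refl _ Y _ ⟩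
      (1# + x^ suc s + x^ (suc s ℕ.+ suc s)) * ∑< (suc n) f
        ≈⟨ *-congˡ (∑<-χ-term s n (ℕ.<⇒≤ s<n)) ⟩
      (1# + x^ suc s + x^ (suc s ℕ.+ suc s)) * prod s
        ∎
      where
      X = 1# + x^ (suc s ℕ.+ suc s)
      Y = x^ suc s
      f g : ℕ → Carrier
      f m = χ m * term s m
      g m = χ m * (term s (m ∸ 1) + term s (suc m))

      drop : ∀ {y z} m → s ℕ.< m → y + z * term s m ≈ y
      drop m s<m = trans (+-congˡ (trans (*-congˡ (term-vanish s<m)) (zeroʳ _))) (+-identityʳ _)

      ∑g≈∑f : ∑< (suc n) g ≈ ∑< (suc n) f
      ∑g≈∑f = begin
        ∑< (suc n) g                            ≈⟨ drop n s<n ⟨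
        ∑< (suc n) g + χ (suc n) * term s n     ≈⟨ ∑<-χ (term s) n ⟩
        ∑< (suc n) f + χ n * term s (suc n)     ≈⟨ drop (suc n) (ℕ.m<n⇒m<1+n s<n) ⟩
        ∑< (suc n) f                            ∎

    -- The exponent splits as 5 tri m = tri m + m(m + 1) + m(m + 1). One copy of m(m + 1) is spent
    -- on `C-central`, the other on `C-linearize`, and tri m goes into the product formula once the
    -- sum over m has been moved inside.
    alternating-sum : ∀ L M → L ℕ.≤ M →
      ∑< (suc M) (λ m → χ m * (x^ (5 ℕ.* tri m) * C (L ℕ.+ L) (L ℕ.+ suc (m ℕ.+ m)))) ≈
      ∑< (suc M ℕ.+ L) (λ i → x^ (i ℕ.* suc i) * ∑< (suc i) (λ s → weight L i s * prod s))
    alternating-sum L M L≤M = begin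
      ∑< (suc M) (λ m → χ m * (x^ (5 ℕ.* tri m) * B m))
        ≈⟨ ∑<-cong (suc M) {λ m → χ m * (x^ (5 ℕ.* tri m) * B m)}
             {λ m → ∑< N (λ i → E i * ∑< (suc i) (λ s → W i s m))} expand ⟩
      ∑< (suc M) (λ m → ∑< N (λ i → E i * ∑< (suc i) (λ s → W i s m)))
        ≈⟨ ∑<-swap (suc M) N (λ m i → E i * ∑< (suc i) (λ s → W i s m)) ⟩
      ∑< N (λ i → ∑< (suc M) (λ m → E i * ∑< (suc i) (λ s → W i s m)))
        ≈⟨ ∑<-cong N {λ i → ∑< (suc M) (λ m → E i * ∑< (suc i) (λ s → W i s m))}
             {λ i → E i * ∑< (suc i) (λ s → weight L i s * prod s)} (λ i _ → collapse i) ⟩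
      ∑< N (λ i → E i * ∑< (suc i) (λ s → weight L i s * prod s))
        ∎
      where
      N = suc M ℕ.+ L
      B E : ℕ → Carrier
      B m = C (L ℕ.+ L) (L ℕ.+ suc (m ℕ.+ m))
      E i = x^ (i ℕ.* suc i)
      W : ℕ → ℕ → ℕ → Carrier
      W i s m = weight L i s * (χ m * term s m)

      five : ∀ m → 5 ℕ.* tri m ≡ tri m ℕ.+ (m ℕ.* suc m ℕ.+ m ℕ.* suc m)
      five m = ≡.subst (λ k → 5 ℕ.* tri m ≡ tri m ℕ.+ (k ℕ.+ k)) (tri+tri m) (lemma (tri m))
        where
        lemma : ∀ t → 5 ℕ.* t ≡ t ℕ.+ (t ℕ.+ t ℕ.+ (t ℕ.+ t))
        lemma = ℕ-Solver.solve-∀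

      expand : ∀ m → m ℕ.< suc M →
        χ m * (x^ (5 ℕ.* tri m) * B m) ≈ ∑< N (λ i → E i * ∑< (suc i) (λ s → W i s m))
      expand m m<M = begin
        χ m * (x^ (5 ℕ.* tri m) * B m)
          ≈⟨ *-congˡ (*-congʳ (trans (x^-cong (five m)) (trans (x^-+ (tri m) _) (*-congˡ (x^-+ (m ℕ.* suc m) _))))) ⟩
        χ m * (x^ tri m * (E m * E m) * B m)
          ≈⟨ solve 4 (λ c t e b → c :* (t :* (e :* e) :* b) := c :* t :* e :* (e :* b)) refl _ _ _ _ ⟩
        χ m * x^ tri m * E m * (E m * B m)
          ≈⟨ *-congˡ (C-central L m N (ℕ.+-monoˡ-< L m<M)) ⟩
        χ m * x^ tri m * E m * ∑< N (λ i → E i * D i)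
          ≈⟨ ∑<-* N _ (λ i → E i * D i) ⟨
        ∑< N (λ i → χ m * x^ tri m * E m * (E i * D i))
          ≈⟨ ∑<-cong N {λ i → χ m * x^ tri m * E m * (E i * D i)}
               {λ i → E i * ∑< (suc i) (λ s → W i s m)} (λ i _ → inner i) ⟩
        ∑< N (λ i → E i * ∑< (suc i) (λ s → W i s m))
          ∎
        where
        D : ℕ → Carrier
        D i = shift (C L) i m * C L (i ℕ.+ suc m)

        inner : ∀ i → χ m * x^ tri m * E m * (E i * D i) ≈ E i * ∑< (suc i) (λ s → W i s m)
        inner i = begin
          χ m * x^ tri m * E m * (E i * D i)
            ≈⟨ solve 4 (λ y e f d → y :* e :* (f :* d) := f :* (y :* (e :* d))) refl
                 (χ m * x^ tri m) (E m) (E i) (D i) ⟩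
          E i * (χ m * x^ tri m * (E m * D i))
            ≈⟨ *-congˡ (*-congˡ (C-linearize L m i)) ⟩
          E i * (χ m * x^ tri m * ∑< (suc i) V)
            ≈⟨ *-congˡ (∑<-* (suc i) _ V) ⟨
          E i * ∑< (suc i) (λ s → χ m * x^ tri m * V s)
            ≈⟨ *-congˡ (∑<-cong (suc i) {λ s → χ m * x^ tri m * V s} {λ s → W i s m} (λ s _ →
                 solve 4 (λ c t w b → c :* t :* (w :* b) := w :* (c :* (t :* b))) refl
                   (χ m) (x^ tri m) (weight L i s) (C (suc (s ℕ.+ s)) (suc (s ℕ.+ m))))) ⟩
          E i * ∑< (suc i) (λ s → W i s m)
            ∎
          where
          V : ℕ → Carrier
          V s = weight L i s * C (suc (s ℕ.+ s)) (suc (s ℕ.+ m))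

      collapse : ∀ i → ∑< (suc M) (λ m → E i * ∑< (suc i) (λ s → W i s m)) ≈
                       E i * ∑< (suc i) (λ s → weight L i s * prod s)
      collapse i = begin
        ∑< (suc M) (λ m → E i * ∑< (suc i) (λ s → W i s m))
          ≈⟨ ∑<-* (suc M) (E i) (λ m → ∑< (suc i) (λ s → W i s m)) ⟩
        E i * ∑< (suc M) (λ m → ∑< (suc i) (λ s → W i s m))
          ≈⟨ *-congˡ (∑<-swap (suc M) (suc i) (λ m s → W i s m)) ⟩
        E i * ∑< (suc i) (λ s → ∑< (suc M) (λ m → W i s m))
          ≈⟨ *-congˡ (∑<-cong (suc i) {λ s → ∑< (suc M) (W i s)}
               {λ s → weight L i s * prod s} (λ s _ → sum-m s)) ⟩
        E i * ∑< (suc i) (λ s → weight L i s * prod s)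
          ∎
        where
        sum-m : ∀ s → ∑< (suc M) (W i s) ≈ weight L i s * prod s
        sum-m s = trans (∑<-* (suc M) (weight L i s) (λ m → χ m * term s m)) product
          where
          product : weight L i s * ∑< (suc M) (λ m → χ m * term s m) ≈ weight L i s * prod s
          product with s ℕ.≤? M
          ... | yes s≤M = *-congˡ (∑<-χ-term s M s≤M)
          -- The product formula covers s ≤ M only; for larger s, L ≤ M < s forces [L, 2s + 1] = 0.
          ... | no  s≰M = trans (trans (*-congʳ w≈0) (zeroˡ _)) (sym (trans (*-congʳ w≈0) (zeroˡ _)))
            where
            w≈0 = weight-vanish₀ L i s
              (s≤s (ℕ.≤-trans (ℕ.≤-trans L≤M (ℕ.<⇒≤ (ℕ.≰⇒> s≰M))) (ℕ.m≤m+n s s)))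

    -- The final expression contains no subtraction, so any property of 0, 1 and the powers that is
    -- stable under sums and products passes to it. Nonnegativity and the degree bound are thus
    -- carried along together.
    module Positivity {p} (P : Carrier → Set p)
      (P-0# : P 0#) (P-1# : P 1#) (P-x^ : ∀ k → P (x^ k))
      (P-+ : ∀ {y z} → P y → P z → P (y + z))
      (P-* : ∀ {y z} → P y → P z → P (y * z))
      where

      P-∑< : ∀ n {f} → (∀ i → P (f i)) → P (∑< n f)
      P-∑< zero    pf = P-0#
      P-∑< (suc n) pf = P-+ (pf 0) (P-∑< n (λ i → pf (suc i)))

      P-C : ∀ n k → P (C n k)
      P-C n       zero    = P-1#
      P-C zero    (suc k) = P-0#
      P-C (suc n) (suc k) = P-+ (P-C n k) (P-* (P-x^ (suc k)) (P-C n (suc k)))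

      P-weight : ∀ L i s → P (weight L i s)
      P-weight L i s = P-* (P-x^ _) (P-* (P-C L (suc (s ℕ.+ s))) (P-C _ (i ∸ s)))

      P-prod : ∀ s → P (prod s)
      P-prod zero    = P-1#
      P-prod (suc s) = P-* (P-+ (P-+ P-1# (P-x^ (suc s))) (P-x^ _)) (P-prod s)

      P-alternating : ∀ L N →
        P (∑< N (λ i → x^ (i ℕ.* suc i) * ∑< (suc i) (λ s → weight L i s * prod s)))
      P-alternating L N = P-∑< N (λ i → P-* (P-x^ (i ℕ.* suc i))
        (P-∑< (suc i) {λ s → weight L i s * prod s} (λ s → P-* (P-weight L i s) (P-prod s))))

-- The ring of power series

open ≡ using (cong; cong₂; sym; trans; refl; module ≡-Reasoning)

infixl 6 _⊕_
_⊕_ : Series → Series → Series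
(f ⊕ g) n = f n ℤ.+ g n

-- By computation `(f ⊛ g) (suc n)` is `f (suc n) ℤ.* g 0 ℤ.+ (f ⊛ (g ∘ suc)) n`. This and the
-- following inductions on n therefore shift the right factor.
⊛-congˡ : ∀ f {g h} → g ≗ h → f ⊛ g ≗ f ⊛ h
⊛-congˡ f g≗h zero    = cong (λ x → f 0 ℤ.* x ℤ.+ 0ℤ) (g≗h 0)
⊛-congˡ f g≗h (suc n) = cong₂ ℤ._+_ (cong (f (suc n) ℤ.*_) (g≗h 0)) (⊛-congˡ f (g≗h ∘ suc) n)

-- The mirrored recursion, which splits off the last summand and shifts the left factor. Together
-- with the defining one it yields commutativity.
⊛-suc : ∀ f g n → (f ⊛ g) (suc n) ≡ ((f ∘ suc) ⊛ g) n ℤ.+ f 0 ℤ.* g (suc n)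
⊛-suc f g zero    = lemma (f 1 ℤ.* g 0) (f 0 ℤ.* g 1)
  where
  lemma : ∀ x y → x ℤ.+ (y ℤ.+ 0ℤ) ≡ x ℤ.+ 0ℤ ℤ.+ y
  lemma = ℤ-Solver.solve-∀
⊛-suc f g (suc n) = trans (cong (λ x → f (suc (suc n)) ℤ.* g 0 ℤ.+ x) (⊛-suc f (g ∘ suc) n))
                          (sym (ℤ.+-assoc (f (suc (suc n)) ℤ.* g 0) _ _))

⊛-comm : ∀ f g → f ⊛ g ≗ g ⊛ f
⊛-comm f g zero    = cong (ℤ._+ 0ℤ) (ℤ.*-comm (f 0) (g 0))
⊛-comm f g (suc n) = begin
  f (suc n) ℤ.* g 0 ℤ.+ (f ⊛ (g ∘ suc)) n
    ≡⟨ cong₂ ℤ._+_ (ℤ.*-comm (f (suc n)) (g 0)) (⊛-comm f (g ∘ suc) n) ⟩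
  g 0 ℤ.* f (suc n) ℤ.+ ((g ∘ suc) ⊛ f) n
    ≡⟨ ℤ.+-comm (g 0 ℤ.* f (suc n)) _ ⟩
  ((g ∘ suc) ⊛ f) n ℤ.+ g 0 ℤ.* f (suc n)
    ≡⟨ ⊛-suc g f n ⟨
  (g ⊛ f) (suc n)
    ∎
  where open ≡-Reasoning

⊛-distribˡ-⊕ : ∀ f g h → f ⊛ (g ⊕ h) ≗ f ⊛ g ⊕ f ⊛ h
⊛-distribˡ-⊕ f g h zero    = lemma (f 0) (g 0) (h 0)
  where
  lemma : ∀ x y z → x ℤ.* (y ℤ.+ z) ℤ.+ 0ℤ ≡ x ℤ.* y ℤ.+ 0ℤ ℤ.+ (x ℤ.* z ℤ.+ 0ℤ)
  lemma = ℤ-Solver.solve-∀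
⊛-distribˡ-⊕ f g h (suc n) = trans (cong (λ x → f (suc n) ℤ.* (g 0 ℤ.+ h 0) ℤ.+ x)
                                       (⊛-distribˡ-⊕ f (g ∘ suc) (h ∘ suc) n))
                                 (lemma (f (suc n)) (g 0) (h 0) _ _)
  where
  lemma : ∀ x y z u v → x ℤ.* (y ℤ.+ z) ℤ.+ (u ℤ.+ v) ≡ x ℤ.* y ℤ.+ u ℤ.+ (x ℤ.* z ℤ.+ v)
  lemma = ℤ-Solver.solve-∀

⊛-scale : ∀ c f g → f ⊛ (λ n → g n ℤ.* c) ≗ λ n → (f ⊛ g) n ℤ.* c
⊛-scale c f g zero    = lemma (f 0) (g 0) c
  where
  lemma : ∀ x y c → x ℤ.* (y ℤ.* c) ℤ.+ 0ℤ ≡ (x ℤ.* y ℤ.+ 0ℤ) ℤ.* c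
  lemma = ℤ-Solver.solve-∀
⊛-scale c f g (suc n) = trans (cong (λ x → f (suc n) ℤ.* (g 0 ℤ.* c) ℤ.+ x) (⊛-scale c f (g ∘ suc) n))
                              (lemma (f (suc n)) (g 0) c _)
  where
  lemma : ∀ x y c u → x ℤ.* (y ℤ.* c) ℤ.+ u ℤ.* c ≡ (x ℤ.* y ℤ.+ u) ℤ.* c
  lemma = ℤ-Solver.solve-∀

-- Induction shifts h. The tail of `g ⊛ h` is the tail of g scaled by `h 0`, plus `g ⊛ (h ∘ suc)`,
-- so `⊛-scale` and distributivity reassemble the right side.
⊛-assoc : ∀ f g h → (f ⊛ g) ⊛ h ≗ f ⊛ (g ⊛ h)
⊛-assoc f g h zero    = lemma (f 0) (g 0) (h 0)
  where
  lemma : ∀ x y z → (x ℤ.* y ℤ.+ 0ℤ) ℤ.* z ℤ.+ 0ℤ ≡ x ℤ.* (y ℤ.* z ℤ.+ 0ℤ) ℤ.+ 0ℤ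
  lemma = ℤ-Solver.solve-∀
⊛-assoc f g h (suc n) = begin
  (f (suc n) ℤ.* g 0 ℤ.+ (f ⊛ (g ∘ suc)) n) ℤ.* h 0 ℤ.+ ((f ⊛ g) ⊛ (h ∘ suc)) n
    ≡⟨ cong (λ x → (f (suc n) ℤ.* g 0 ℤ.+ (f ⊛ (g ∘ suc)) n) ℤ.* h 0 ℤ.+ x) (⊛-assoc f g (h ∘ suc) n) ⟩
  (f (suc n) ℤ.* g 0 ℤ.+ (f ⊛ (g ∘ suc)) n) ℤ.* h 0 ℤ.+ (f ⊛ (g ⊛ (h ∘ suc))) n
    ≡⟨ lemma (f (suc n)) (g 0) (h 0) _ _ ⟩
  f (suc n) ℤ.* (g 0 ℤ.* h 0 ℤ.+ 0ℤ) ℤ.+ ((f ⊛ (g ∘ suc)) n ℤ.* h 0 ℤ.+ (f ⊛ (g ⊛ (h ∘ suc))) n)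
    ≡⟨ cong (λ x → f (suc n) ℤ.* (g 0 ℤ.* h 0 ℤ.+ 0ℤ) ℤ.+ (x ℤ.+ (f ⊛ (g ⊛ (h ∘ suc))) n))
         (⊛-scale (h 0) f (g ∘ suc) n) ⟨
  f (suc n) ℤ.* (g 0 ℤ.* h 0 ℤ.+ 0ℤ) ℤ.+ ((f ⊛ (λ n → g (suc n) ℤ.* h 0)) n ℤ.+ (f ⊛ (g ⊛ (h ∘ suc))) n)
    ≡⟨ cong (λ x → f (suc n) ℤ.* (g 0 ℤ.* h 0 ℤ.+ 0ℤ) ℤ.+ x)
         (⊛-distribˡ-⊕ f (λ n → g (suc n) ℤ.* h 0) (g ⊛ (h ∘ suc)) n) ⟨
  (f ⊛ (g ⊛ h)) (suc n)
    ∎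
  where
  open ≡-Reasoning
  lemma : ∀ x y z u v → (x ℤ.* y ℤ.+ u) ℤ.* z ℤ.+ v ≡ x ℤ.* (y ℤ.* z ℤ.+ 0ℤ) ℤ.+ (u ℤ.* z ℤ.+ v)
  lemma = ℤ-Solver.solve-∀

⊛-zeroʳ : ∀ f → f ⊛ 𝟘 ≗ 𝟘
⊛-zeroʳ f zero    = cong (ℤ._+ 0ℤ) (ℤ.*-zeroʳ (f 0))
⊛-zeroʳ f (suc n) = cong₂ ℤ._+_ (ℤ.*-zeroʳ (f (suc n))) (⊛-zeroʳ f n)

⊛-identityʳ : ∀ f → f ⊛ q^ 0 ≗ f
⊛-identityʳ f zero    = trans (ℤ.+-identityʳ _) (ℤ.*-identityʳ (f 0))
⊛-identityʳ f (suc n) = trans (cong₂ ℤ._+_ (ℤ.*-identityʳ (f (suc n))) (⊛-zeroʳ f n)) (ℤ.+-identityʳ _)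

seriesRing : CommutativeRing _ _
seriesRing = record
  { Carrier = Series
  ; _≈_ = _≗_
  ; _+_ = _⊕_
  ; _*_ = _⊛_
  ; -_  = λ f n → ℤ.- f n
  ; 0#  = 𝟘
  ; 1#  = q^ 0
  ; isCommutativeRing = record
    { isRing = record
      { +-isAbelianGroup = Pointwise.isAbelianGroup ℕ ℤ.+-0-isAbelianGroup
      ; *-cong = λ {f} {g} {h} {k} f≗g h≗k n → trans (⊛-congˡ f h≗k n)
          (trans (⊛-comm f k n) (trans (⊛-congˡ k f≗g n) (⊛-comm k g n)))
      ; *-assoc = ⊛-assoc
      ; *-identity = (λ f n → trans (⊛-comm (q^ 0) f n) (⊛-identityʳ f n)) , ⊛-identityʳ
      ; distrib = ⊛-distribˡ-⊕ , λ f g h n → trans (⊛-comm (g ⊕ h) f n)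
          (trans (⊛-distribˡ-⊕ f g h n) (cong₂ ℤ._+_ (⊛-comm f g n) (⊛-comm f h n)))
      }
    ; *-comm = ⊛-comm
    }
  }

module 𝕊 = CommutativeRing seriesRing

-- Powers of q, cancellation, and the passage from `gauss` to `C`.

q^-⊛-zero : ∀ k f → (q^ suc k ⊛ f) 0 ≡ 0ℤ
q^-⊛-zero k f = trans (ℤ.+-identityʳ (0ℤ ℤ.* f 0)) (ℤ.*-zeroˡ (f 0))

q^-⊛-suc : ∀ k f n → (q^ suc k ⊛ f) (suc n) ≡ (q^ k ⊛ f) n
q^-⊛-suc k f n = trans (⊛-suc (q^ suc k) f n)
  (trans (cong (λ x → (q^ k ⊛ f) n ℤ.+ x) (ℤ.*-zeroˡ (f (suc n)))) (ℤ.+-identityʳ _))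

q^-⊛-+ : ∀ k f n → (q^ k ⊛ f) (k ℕ.+ n) ≡ f n
q^-⊛-+ zero    f n = 𝕊.*-identityˡ f n
q^-⊛-+ (suc k) f n = trans (q^-⊛-suc k f (k ℕ.+ n)) (q^-⊛-+ k f n)

q^-⊛-< : ∀ k f {n} → n ℕ.< k → (q^ k ⊛ f) n ≡ 0ℤ
q^-⊛-< (suc k) f {zero}  _         = q^-⊛-zero k f
q^-⊛-< (suc k) f {suc n} (s≤s n<k) = trans (q^-⊛-suc k f n) (q^-⊛-< k f n<k)

q^-+ : ∀ k l → q^ (k ℕ.+ l) ≗ q^ k ⊛ q^ l
q^-+ zero    l n       = sym (𝕊.*-identityˡ (q^ l) n)
q^-+ (suc k) l zero    = sym (q^-⊛-zero k (q^ l))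
q^-+ (suc k) l (suc n) = trans (q^-+ k l n) (sym (q^-⊛-suc k (q^ l) n))

open QBinomial seriesRing q^_ (λ _ → refl) q^-+

fac≗⟨q⟩ : ∀ m → fac m ≗ ⟨q⟩ m
fac≗⟨q⟩ zero    _ = refl
fac≗⟨q⟩ (suc m) n = 𝕊.*-congʳ {q^ 0 ⊝ q^ suc m} (fac≗⟨q⟩ m) n

-- A series with constant term 1 is invertible: long division of 1 by h gives the inverse.
⊛-cancelʳ : ∀ h → h 0 ≡ 1ℤ → ∀ {f g} → f ⊛ h ≗ g ⊛ h → f ≗ g
⊛-cancelʳ h h₀ {f} {g} eq = 𝕊.trans (𝕊.sym (back f)) (𝕊.trans (𝕊.*-congʳ {h⁻¹} eq) (back g))
  where
  h⁻¹ = q^ 0 ⊘ h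
  back : ∀ f → (f ⊛ h) ⊛ h⁻¹ ≗ f
  back f = 𝕊.trans (𝕊.*-assoc f h h⁻¹)
    (𝕊.trans (𝕊.*-congˡ {f} (𝕊.trans (𝕊.*-comm h h⁻¹) (⊘-⊛ (q^ 0) h h₀))) (𝕊.*-identityʳ f))

fac-cancel : ∀ m {f g} → f ⊛ fac m ≗ g ⊛ fac m → f ≗ g
fac-cancel m = ⊛-cancelʳ (fac m) (trans (fac≗⟨q⟩ m 0) (⟨q⟩-const m))

open Cancellative fac-cancel

-- Both become `⟨q⟩ (m ℕ.+ n)` when multiplied by the q-factorials of m and n, which can be
-- cancelled.
gauss≗C : ∀ m n → gauss (+ m) (+ n) ≗ C (m ℕ.+ n) m
gauss≗C m n = cancel₂ m n (𝕊.trans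
  (𝕊.*-congˡ {gauss (+ m) (+ n)} (𝕊.*-cong (fac≗⟨q⟩ m) (fac≗⟨q⟩ n)))
  (𝕊.trans (gauss-⊛ m n) (𝕊.sym (𝕊.trans (C-fac m n) (fac≗⟨q⟩ (m ℕ.+ n))))))


-- Polynomials with nonnegative coefficients.

Good : Series → Set
Good f = (∀ n → 0ℤ ℤ.≤ f n) × ∃[ d ] ∀ n → d ℕ.< n → f n ≡ 0ℤ

Good-resp : ∀ {f g} → f ≗ g → Good f → Good g
Good-resp f≗g (f≥0 , d , f≡0) =
  (λ n → ≡.subst (0ℤ ℤ.≤_) (f≗g n) (f≥0 n)) , d , (λ n d<n → trans (sym (f≗g n)) (f≡0 n d<n))

Good-𝟘 : Good 𝟘
Good-𝟘 = (λ _ → ℤ.≤-refl) , 0 , (λ _ _ → refl)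

Good-q^ : ∀ k → Good (q^ k)
Good-q^ k = nonneg , k , vanish k
  where
  nonneg : ∀ n → 0ℤ ℤ.≤ (q^ k) n
  nonneg n with k ℕ.≡ᵇ n
  ... | true  = ℤ.+≤+ z≤n
  ... | false = ℤ.+≤+ z≤n

  vanish : ∀ k n → k ℕ.< n → (q^ k) n ≡ 0ℤ
  vanish zero    (suc n) _         = refl
  vanish (suc k) (suc n) (s≤s k<n) = vanish k n k<n

Good-⊕ : ∀ {f g} → Good f → Good g → Good (f ⊕ g)
Good-⊕ (f≥0 , d , f≡0) (g≥0 , e , g≡0) =
  (λ n → ℤ.+-mono-≤ (f≥0 n) (g≥0 n)) , d ℕ.+ e , λ n lt →
  cong₂ ℤ._+_ (f≡0 n (ℕ.≤-<-trans (ℕ.m≤m+n d e) lt)) (g≡0 n (ℕ.≤-<-trans (ℕ.m≤n+m e d) lt))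

*-nonNeg : ∀ {i j} → 0ℤ ℤ.≤ i → 0ℤ ℤ.≤ j → 0ℤ ℤ.≤ i ℤ.* j
*-nonNeg {i} {+ j} 0≤i _ = ≡.subst (ℤ._≤ i ℤ.* + j) (ℤ.*-zeroˡ (+ j)) (ℤ.*-monoʳ-≤-nonNeg (+ j) 0≤i)

⊛-nonNeg : ∀ f g → (∀ n → 0ℤ ℤ.≤ f n) → (∀ n → 0ℤ ℤ.≤ g n) → ∀ n → 0ℤ ℤ.≤ (f ⊛ g) n
⊛-nonNeg f g f≥0 g≥0 zero    = ℤ.+-mono-≤ (*-nonNeg (f≥0 0) (g≥0 0)) ℤ.≤-refl
⊛-nonNeg f g f≥0 g≥0 (suc n) =
  ℤ.+-mono-≤ (*-nonNeg (f≥0 (suc n)) (g≥0 0)) (⊛-nonNeg f (g ∘ suc) f≥0 (g≥0 ∘ suc) n)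

-- Each summand peeled off lowers the degree bound of g by one, and its factor from f vanishes
-- because the index still exceeds d. When the bound of g reaches 0, the remaining tail of g is
-- zero.
⊛-vanish : ∀ f g {d} e → (∀ n → d ℕ.< n → f n ≡ 0ℤ) → (∀ n → e ℕ.< n → g n ≡ 0ℤ) →
           ∀ n → e ℕ.+ d ℕ.< n → (f ⊛ g) n ≡ 0ℤ
⊛-vanish f g {d} e f≡0 g≡0 (suc n) lt = cong₂ ℤ._+_
  (trans (cong (ℤ._* g 0) (f≡0 (suc n) (ℕ.≤-<-trans (ℕ.m≤n+m d e) lt))) (ℤ.*-zeroˡ (g 0)))
  (tail e g≡0 lt)
  where
  tail : ∀ e → (∀ n → e ℕ.< n → g n ≡ 0ℤ) → e ℕ.+ d ℕ.< suc n → (f ⊛ (g ∘ suc)) n ≡ 0ℤ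
  tail zero    g≡0 _        = trans (⊛-congˡ f (λ n → g≡0 (suc n) (s≤s z≤n)) n) (⊛-zeroʳ f n)
  tail (suc e) g≡0 (s≤s lt) = ⊛-vanish f (g ∘ suc) e f≡0 (λ n e<n → g≡0 (suc n) (s≤s e<n)) n lt

Good-⊛ : ∀ {f g} → Good f → Good g → Good (f ⊛ g)
Good-⊛ {f} {g} (f≥0 , d , f≡0) (g≥0 , e , g≡0) =
  ⊛-nonNeg f g f≥0 g≥0 , e ℕ.+ d , ⊛-vanish f g e f≡0 g≡0

open Positivity Good Good-𝟘 (Good-q^ 0) Good-q^ Good-⊕ Good-⊛

-- The χ-weighted sum as a series, and the values of χ.

shifted-C : ℕ → ℕ → Series
shifted-C L m = q^ (5 ℕ.* tri m) ⊛ C (L ℕ.+ L) (L ℕ.+ suc (m ℕ.+ m))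

total : ℕ → ℕ → Series
total L M = ∑< (suc M) (λ m → χ m ⊛ shifted-C L m)

Good-total : ∀ L M → L ℕ.≤ M → Good (total L M)
Good-total L M L≤M = Good-resp (𝕊.sym (alternating-sum L M L≤M)) (P-alternating L (suc M ℕ.+ L))

-- Three steps of the recurrence negate χ. Hence it is (-1)^i at 3i, 0 at 3i + 1 and (-1)^(i+1) at
-- 3i + 2, which are the signs in the sum over j.
χ-1+3i : ∀ i → χ (suc (i ℕ.* 3)) ≗ 𝟘
χ-3+3i : ∀ i → χ (suc i ℕ.* 3) ≗ λ n → ℤ.- χ (i ℕ.* 3) n

χ-3+3i i n = lemma (χ (suc (i ℕ.* 3)) n) (χ (i ℕ.* 3) n)
  where
  lemma : ∀ x y → x ℤ.- y ℤ.- x ≡ ℤ.- y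
  lemma = ℤ-Solver.solve-∀

χ-1+3i zero    n = refl
χ-1+3i (suc i) n = trans (lemma (χ (suc (i ℕ.* 3)) n) (χ (i ℕ.* 3) n)) (cong ℤ.-_ (χ-1+3i i n))
  where
  lemma : ∀ x y → (x ℤ.- y ℤ.- x) ℤ.- (x ℤ.- y) ≡ ℤ.- x
  lemma = ℤ-Solver.solve-∀

neg-⊛ : ∀ f g n → ((λ n → ℤ.- f n) ⊛ g) n ≡ ℤ.- (f ⊛ g) n
neg-⊛ f g n = sym (-‿distribˡ-* f g n)
  where open import Algebra.Properties.Ring 𝕊.ring using (-‿distribˡ-*)

χ₀-⊛ : ∀ i f n → (χ (i ℕ.* 3) ⊛ f) n ≡ -1ℤ ℤ.^ i ℤ.* f n
χ₀-⊛ zero    f n = trans (𝕊.*-identityˡ f n) (sym (ℤ.*-identityˡ (f n)))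
χ₀-⊛ (suc i) f n = begin
  (χ (suc i ℕ.* 3) ⊛ f) n               ≡⟨ 𝕊.*-congʳ {f} (χ-3+3i i) n ⟩
  ((λ n → ℤ.- χ (i ℕ.* 3) n) ⊛ f) n     ≡⟨ neg-⊛ (χ (i ℕ.* 3)) f n ⟩
  ℤ.- (χ (i ℕ.* 3) ⊛ f) n               ≡⟨ cong ℤ.-_ (χ₀-⊛ i f n) ⟩
  ℤ.- (-1ℤ ℤ.^ i ℤ.* f n)               ≡⟨ ℤ.-1*i≡-i _ ⟨
  -1ℤ ℤ.* (-1ℤ ℤ.^ i ℤ.* f n)           ≡⟨ ℤ.*-assoc -1ℤ (-1ℤ ℤ.^ i) (f n) ⟨
  -1ℤ ℤ.^ suc i ℤ.* f n                 ∎
  where open ≡-Reasoning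

χ₁-⊛ : ∀ i f n → (χ (suc (i ℕ.* 3)) ⊛ f) n ≡ 0ℤ
χ₁-⊛ i f n = trans (𝕊.*-congʳ {f} (χ-1+3i i) n) (𝕊.zeroˡ f n)

χ₂-⊛ : ∀ i f n → (χ (suc (suc (i ℕ.* 3))) ⊛ f) n ≡ -1ℤ ℤ.^ suc i ℤ.* f n
χ₂-⊛ i f n = trans (𝕊.*-congʳ {f} (λ n → lemma n) n) (χ₀-⊛ (suc i) f n)
  where
  lemma : ∀ n → χ (suc (suc (i ℕ.* 3))) n ≡ χ (suc i ℕ.* 3) n
  lemma n = sym (trans (cong (λ x → χ (suc (suc (i ℕ.* 3))) n ℤ.- x) (χ-1+3i i n)) (ℤ.+-identityʳ _))

∑<-triple : ∀ B (f : ℕ → Series) n →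
  ∑< (B ℕ.* 3) f n ≡
  ℤ-Sum.sum (λ (i : Fin B) →
    f (toℕ i ℕ.* 3) n ℤ.+ (f (suc (toℕ i ℕ.* 3)) n ℤ.+ f (suc (suc (toℕ i ℕ.* 3))) n))
∑<-triple zero    f n = refl
∑<-triple (suc B) f n = trans
  (cong (λ x → f 0 n ℤ.+ (f 1 n ℤ.+ (f 2 n ℤ.+ x))) (∑<-triple B (f ∘ (3 ℕ.+_)) n))
  (lemma (f 0 n) (f 1 n) (f 2 n) _)
  where
  lemma : ∀ x y z u → x ℤ.+ (y ℤ.+ (z ℤ.+ u)) ≡ x ℤ.+ (y ℤ.+ z) ℤ.+ u
  lemma = ℤ-Solver.solve-∀

-- Matching the terms m with the integers j.

sumℤ-cong : ∀ B {s t} → (∀ j → s j ≡ t j) → sumℤ B s ≡ sumℤ B t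
sumℤ-cong B eq = cong₂ ℤ._+_ (eq 0ℤ) (ℤ-Sum.sum-cong-≗ {B} (λ i → cong₂ ℤ._+_ (eq _) (eq _)))

-- The term j of G is the term m of total with 2m + 1 = |6j + 1|.
index : ℤ → ℕ
index (+ a)    = a ℕ.* 3
index -[1+ i ] = suc (suc (i ℕ.* 3))

-- The term m = 0 is j = 0. Each block 3i + 1, 3i + 2, 3i + 3 of later terms contributes 0, the term
-- j = -(i + 1) and the term j = i + 1.
total-sumℤ : ∀ L B n → total L (B ℕ.* 3) n ≡
                       sumℤ B (λ j → -1ℤ ℤ.^ ℤ.∣ j ∣ ℤ.* shifted-C L (index j) n)
total-sumℤ L B n = cong₂ ℤ._+_ (χ₀-⊛ 0 (shifted-C L 0) n)
  (trans (∑<-triple B (λ m → χ (suc m) ⊛ shifted-C L (suc m)) n)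
         (ℤ-Sum.sum-cong-≗ {B} (λ i → step (toℕ i))))
  where
  step : ∀ i → (χ (suc (i ℕ.* 3)) ⊛ shifted-C L (suc (i ℕ.* 3))) n ℤ.+
               ((χ (suc (suc (i ℕ.* 3))) ⊛ shifted-C L (suc (suc (i ℕ.* 3)))) n ℤ.+
                (χ (suc i ℕ.* 3) ⊛ shifted-C L (suc i ℕ.* 3)) n) ≡
               -1ℤ ℤ.^ suc i ℤ.* shifted-C L (suc i ℕ.* 3) n ℤ.+
               -1ℤ ℤ.^ suc i ℤ.* shifted-C L (suc (suc (i ℕ.* 3))) n
  step i = trans (cong₂ ℤ._+_ (χ₁-⊛ i (shifted-C L (suc (i ℕ.* 3))) n)
                   (cong₂ ℤ._+_ (χ₂-⊛ i (shifted-C L (suc (suc (i ℕ.* 3)))) n)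
                                  (χ₀-⊛ (suc i) (shifted-C L (suc i ℕ.* 3)) n)))
                 (trans (ℤ.+-identityˡ _)
                        (ℤ.+-comm (-1ℤ ℤ.^ suc i ℤ.* shifted-C L (suc (suc (i ℕ.* 3))) n) _))

-- For the case of a negative argument: `gauss` is 0 there by definition, and this inequality makes
-- `C K n` vanish as well.
K<n : ∀ p n {K} → -[1+ p ] ℤ.+ + n ≡ + K → K ℕ.< n
K<n p n eq = ℤ.drop‿+<+ (≡.subst₂ ℤ._<_ eq (ℤ.+-identityˡ (+ n)) (ℤ.+-monoˡ-< (+ n) ℤ.-<+))

gaussˡ : ∀ X n {K} → X ℤ.+ + n ≡ + K → gauss X (+ n) ≗ C K n
gaussˡ (+ p)    n refl = 𝕊.trans (gauss≗C p n) (C-sym p n refl)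
gaussˡ -[1+ p ] n eq i = sym (C-vanish (K<n p n eq) i)

gaussʳ : ∀ n X {K} → + n ℤ.+ X ≡ + K → gauss (+ n) X ≗ C K n
gaussʳ n (+ p)    refl = gauss≗C n p
gaussʳ n -[1+ p ] eq i = sym (C-vanish (K<n p n (trans (ℤ.+-comm -[1+ p ] (+ n)) eq)) i)

-- For j = a ≥ 0 the lower index L - 1 - 6a is reflected to L + 1 + 6a, with m = 3a. For j = -(i +
-- 1) it already equals L + 5 + 6i, with m = 3i + 2.
qbinom-C : ∀ l j → let L = suc l; m = index j in
  qbinom (+ l ℤ.+ + suc (suc l)) (+ l ℤ.- + 6 ℤ.* j) ≗ C (L ℕ.+ L) (L ℕ.+ suc (m ℕ.+ m))
qbinom-C l (+ a) = ≡.subst (λ Y → gauss X Y ≗ C (suc l ℕ.+ suc l) n) (sym Y≡n) (gaussˡ X n X+n≡2L)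
  where
  X = + l ℤ.- + 6 ℤ.* + a
  n = suc l ℕ.+ suc (a ℕ.* 3 ℕ.+ a ℕ.* 3)

  lemma₁ : ∀ N M K → N ℤ.+ M ℤ.- (N ℤ.- K) ≡ M ℤ.+ K
  lemma₁ = ℤ-Solver.solve-∀
  lemma₂ : ∀ N M K → N ℤ.- K ℤ.+ (M ℤ.+ K) ≡ N ℤ.+ M
  lemma₂ = ℤ-Solver.solve-∀
  lemma₃ : ∀ l a → suc (suc l) ℕ.+ 6 ℕ.* a ≡ suc l ℕ.+ suc (a ℕ.* 3 ℕ.+ a ℕ.* 3)
  lemma₃ = ℕ-Solver.solve-∀

  M+6a≡n : + suc (suc l) ℤ.+ + 6 ℤ.* + a ≡ + n
  M+6a≡n = trans (cong (λ x → + suc (suc l) ℤ.+ x) (sym (ℤ.pos-* 6 a))) (cong +_ (lemma₃ l a))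

  Y≡n : + l ℤ.+ + suc (suc l) ℤ.- X ≡ + n
  Y≡n = trans (lemma₁ (+ l) (+ suc (suc l)) (+ 6 ℤ.* + a)) M+6a≡n

  X+n≡2L : X ℤ.+ + n ≡ + (suc l ℕ.+ suc l)
  X+n≡2L = trans (cong (λ x → X ℤ.+ x) (sym M+6a≡n))
    (trans (lemma₂ (+ l) (+ suc (suc l)) (+ 6 ℤ.* + a)) (cong +_ (ℕ.+-suc l (suc l))))
qbinom-C l -[1+ i ] = ≡.subst (λ X → gauss X (+ l ℤ.+ + suc (suc l) ℤ.- X) ≗ C (suc l ℕ.+ suc l) n) (sym X≡n)
                        (gaussʳ n Y (trans (lemma₁ (+ n) _) (cong +_ (ℕ.+-suc l (suc l)))))
  where
  n = suc l ℕ.+ suc (suc (suc (i ℕ.* 3)) ℕ.+ suc (suc (i ℕ.* 3)))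
  Y = + l ℤ.+ + suc (suc l) ℤ.- + n

  lemma₁ : ∀ n K → n ℤ.+ (K ℤ.- n) ≡ K
  lemma₁ = ℤ-Solver.solve-∀
  lemma₂ : ∀ N K J → N ℤ.- K ℤ.* (ℤ.- J) ≡ N ℤ.+ K ℤ.* J
  lemma₂ = ℤ-Solver.solve-∀
  lemma₃ : ∀ l i → l ℕ.+ 6 ℕ.* suc i ≡ suc l ℕ.+ suc (suc (suc (i ℕ.* 3)) ℕ.+ suc (suc (i ℕ.* 3)))
  lemma₃ = ℕ-Solver.solve-∀

  X≡n : + l ℤ.- + 6 ℤ.* -[1+ i ] ≡ + n
  X≡n = trans (lemma₂ (+ l) (+ 6) (+ suc i))
    (trans (cong (λ x → + l ℤ.+ x) (sym (ℤ.pos-* 6 (suc i)))) (cong +_ (lemma₃ l i)))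

-- Rational exponents

toℚᵘ-fromℤ : ∀ i → toℚᵘ (fromℤ i) ℚᵘ.≃ mkℚᵘ i 0
toℚᵘ-fromℤ i = ℚ.toℚᵘ-fromℚᵘ (mkℚᵘ i 0)

-- The comparison takes place among unnormalised fractions, where denominators 1 compute without
-- reduction to lowest terms.
fromℤ-+ : ∀ i j → fromℤ (i ℤ.+ j) ≡ fromℤ i ℚ.+ fromℤ j
fromℤ-+ i j = ℚ.toℚᵘ-injective (begin
  toℚᵘ (fromℤ (i ℤ.+ j))                ≈⟨ toℚᵘ-fromℤ (i ℤ.+ j) ⟩
  mkℚᵘ (i ℤ.+ j) 0                      ≈⟨ *≡* (lemma i j) ⟩
  mkℚᵘ i 0 ℚᵘ.+ mkℚᵘ j 0                ≈⟨ ℚᵘ.+-cong (toℚᵘ-fromℤ i) (toℚᵘ-fromℤ j) ⟨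
  toℚᵘ (fromℤ i) ℚᵘ.+ toℚᵘ (fromℤ j)    ≈⟨ ℚ.toℚᵘ-homo-+ (fromℤ i) (fromℤ j) ⟨
  toℚᵘ (fromℤ i ℚ.+ fromℤ j)            ∎)
  where
  open import Relation.Binary.Reasoning.Setoid ℚᵘ.≃-setoid
  lemma : ∀ i j → (i ℤ.+ j) ℤ.* 1ℤ ≡ (i ℤ.* 1ℤ ℤ.+ j ℤ.* 1ℤ) ℤ.* 1ℤ
  lemma = ℤ-Solver.solve-∀

fromℤ-* : ∀ i j → fromℤ (i ℤ.* j) ≡ fromℤ i ℚ.* fromℤ j
fromℤ-* i j = ℚ.toℚᵘ-injective (begin
  toℚᵘ (fromℤ (i ℤ.* j))                ≈⟨ toℚᵘ-fromℤ (i ℤ.* j) ⟩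
  mkℚᵘ i 0 ℚᵘ.* mkℚᵘ j 0                ≈⟨ ℚᵘ.*-cong (toℚᵘ-fromℤ i) (toℚᵘ-fromℤ j) ⟨
  toℚᵘ (fromℤ i) ℚᵘ.* toℚᵘ (fromℤ j)    ≈⟨ ℚ.toℚᵘ-homo-* (fromℤ i) (fromℤ j) ⟨
  toℚᵘ (fromℤ i ℚ.* fromℤ j)            ∎)
  where open import Relation.Binary.Reasoning.Setoid ℚᵘ.≃-setoid

exponent-tri : ∀ j → exponent (+ 5 / 1) (+ 5 / 2) 6 j ≡ fromℤ (+ (5 ℕ.* tri (index j)))
exponent-tri j = begin
  -- By computation α + β = 15 · ½ and α - β = 5 · ½. Pulling out both halves leaves an integer
  -- numerator 6j(15j + 5), which is 4 times the claimed exponent.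
  fromℤ (+ 6) ℚ.* x ℚ.* (fromℤ (+ 15) ℚ.* ½ ℚ.* x ℚ.+ fromℤ (+ 5) ℚ.* ½) ℚ.* ½
    ≡⟨ lemma (fromℤ (+ 6)) (fromℤ (+ 15)) (fromℤ (+ 5)) ½ x ⟩
  fromℤ (+ 6) ℚ.* x ℚ.* (fromℤ (+ 15) ℚ.* x ℚ.+ fromℤ (+ 5)) ℚ.* (½ ℚ.* ½)
    ≡⟨ cong (ℚ._* (½ ℚ.* ½)) homo ⟨
  fromℤ (+ 6 ℤ.* j ℤ.* (+ 15 ℤ.* j ℤ.+ + 5)) ℚ.* (½ ℚ.* ½)
    ≡⟨ cong (λ i → fromℤ i ℚ.* (½ ℚ.* ½)) (numerator j) ⟩
  fromℤ (e ℤ.* + 4) ℚ.* (½ ℚ.* ½)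
    ≡⟨ cong (ℚ._* (½ ℚ.* ½)) (fromℤ-* e (+ 4)) ⟩
  fromℤ e ℚ.* fromℤ (+ 4) ℚ.* (½ ℚ.* ½)
    ≡⟨ ℚ.*-assoc (fromℤ e) (fromℤ (+ 4)) (½ ℚ.* ½) ⟩
  fromℤ e ℚ.* (fromℤ (+ 4) ℚ.* (½ ℚ.* ½))
    ≡⟨ ℚ.*-identityʳ (fromℤ e) ⟩
  fromℤ e
    ∎
  where
  open ≡-Reasoning
  open ℚ-Solver.+-*-Solver
  x = fromℤ j
  e = + (5 ℕ.* tri (index j))

  lemma : ∀ a b c h x → a ℚ.* x ℚ.* (b ℚ.* h ℚ.* x ℚ.+ c ℚ.* h) ℚ.* h ≡
                        a ℚ.* x ℚ.* (b ℚ.* x ℚ.+ c) ℚ.* (h ℚ.* h)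
  lemma = solve 5 (λ a b c h x → a :* x :* (b :* h :* x :+ c :* h) :* h :=
                                 a :* x :* (b :* x :+ c) :* (h :* h)) refl

  homo : fromℤ (+ 6 ℤ.* j ℤ.* (+ 15 ℤ.* j ℤ.+ + 5)) ≡
         fromℤ (+ 6) ℚ.* x ℚ.* (fromℤ (+ 15) ℚ.* x ℚ.+ fromℤ (+ 5))
  homo = trans (fromℤ-* (+ 6 ℤ.* j) (+ 15 ℤ.* j ℤ.+ + 5))
    (cong₂ ℚ._*_ (fromℤ-* (+ 6) j)
      (trans (fromℤ-+ (+ 15 ℤ.* j) (+ 5)) (cong (ℚ._+ fromℤ (+ 5)) (fromℤ-* (+ 15) j))))

  quadruple : ∀ m → + (5 ℕ.* tri m) ℤ.* + 4 ≡ + 10 ℤ.* (+ m ℤ.* + suc m)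
  quadruple m = begin
    + (5 ℕ.* tri m) ℤ.* + 4          ≡⟨ ℤ.pos-* (5 ℕ.* tri m) 4 ⟨
    + (5 ℕ.* tri m ℕ.* 4)            ≡⟨ cong +_ (arith (tri m)) ⟩
    + (10 ℕ.* (tri m ℕ.+ tri m))     ≡⟨ cong (λ k → + (10 ℕ.* k)) (tri+tri m) ⟩
    + (10 ℕ.* (m ℕ.* suc m))         ≡⟨ ℤ.pos-* 10 (m ℕ.* suc m) ⟩
    + 10 ℤ.* + (m ℕ.* suc m)         ≡⟨ cong (+ 10 ℤ.*_) (ℤ.pos-* m (suc m)) ⟩
    + 10 ℤ.* (+ m ℤ.* + suc m)       ∎
    where
    arith : ∀ t → 5 ℕ.* t ℕ.* 4 ≡ 10 ℕ.* (t ℕ.+ t)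
    arith = ℕ-Solver.solve-∀

  numerator : ∀ j → + 6 ℤ.* j ℤ.* (+ 15 ℤ.* j ℤ.+ + 5) ≡ + (5 ℕ.* tri (index j)) ℤ.* + 4
  numerator (+ a) = sym (trans (quadruple (a ℕ.* 3))
    (trans (cong (λ k → + 10 ℤ.* (k ℤ.* (1ℤ ℤ.+ k))) (ℤ.pos-* a 3)) (arith (+ a))))
    where
    arith : ∀ a → + 10 ℤ.* (a ℤ.* + 3 ℤ.* (1ℤ ℤ.+ a ℤ.* + 3)) ≡ + 6 ℤ.* a ℤ.* (+ 15 ℤ.* a ℤ.+ + 5)
    arith = ℤ-Solver.solve-∀
  numerator -[1+ i ] = sym (trans (quadruple (suc (suc (i ℕ.* 3))))
    (trans (cong (λ k → + 10 ℤ.* ((+ 2 ℤ.+ k) ℤ.* (+ 3 ℤ.+ k))) (ℤ.pos-* i 3)) (arith (+ i))))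
    where
    arith : ∀ i → + 10 ℤ.* ((+ 2 ℤ.+ i ℤ.* + 3) ℤ.* (+ 3 ℤ.+ i ℤ.* + 3)) ≡
                  + 6 ℤ.* (ℤ.- (1ℤ ℤ.+ i)) ℤ.* (+ 15 ℤ.* (ℤ.- (1ℤ ℤ.+ i)) ℤ.+ + 5)
    arith = ℤ-Solver.solve-∀

fromSeries-fromℤ : ∀ f n → fromSeries f (fromℤ (+ n)) ≡ f n
fromSeries-fromℤ f n = cong (fromSeries f) (ℚ.normalize-coprime (Coprime.sym (Coprime.1-coprimeTo n)))

-- This dichotomy reduces equations between coefficients at rational exponents to equations at
-- natural ones.
natural? : ∀ r → (∃[ n ] r ≡ fromℤ (+ n)) ⊎ (∀ f → fromSeries f r ≡ 0ℤ)
natural? (mkℚ (+ n)    zero    c) = inj₁ (n , sym (ℚ.normalize-coprime c))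
natural? (mkℚ (+ n)    (suc _) _) = inj₂ (λ _ → refl)
natural? (mkℚ -[1+ n ] _       _) = inj₂ (λ _ → refl)

fromSeries-cong : ∀ {f g} → f ≗ g → ∀ r → fromSeries f r ≡ fromSeries g r
fromSeries-cong f≗g (mkℚ (+ n)    zero    _) = f≗g n
fromSeries-cong f≗g (mkℚ (+ n)    (suc _) _) = refl
fromSeries-cong f≗g (mkℚ -[1+ n ] _       _) = refl

private
  +-∸-cancel : ∀ k e → fromℤ (+ (e ℕ.+ k)) ℚ.- fromℤ (+ e) ≡ fromℤ (+ k)
  +-∸-cancel k e = trans (cong (ℚ._- fromℤ (+ e)) (fromℤ-+ (+ e) (+ k))) (lemma (fromℤ (+ e)) (fromℤ (+ k)))
    where
    open ℚ-Solver.+-*-Solver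
    lemma : ∀ x y → x ℚ.+ y ℚ.- x ≡ y
    lemma = solve 2 (λ x y → x :+ y :- x := y) refl

  -+-cancel : ∀ x y → x ≡ y ℚ.+ (x ℚ.- y)
  -+-cancel = solve 2 (λ x y → x := y :+ (x :- y)) refl
    where open ℚ-Solver.+-*-Solver

fromSeries-q^ : ∀ e f r → (q^ fromℤ (+ e) · fromSeries f) r ≡ fromSeries (q^ e ⊛ f) r
fromSeries-q^ e f r with natural? (r ℚ.- fromℤ (+ e))
... | inj₁ (k , r-e≡k) = begin
  fromSeries f (r ℚ.- fromℤ (+ e))           ≡⟨ cong (fromSeries f) r-e≡k ⟩
  fromSeries f (fromℤ (+ k))                 ≡⟨ fromSeries-fromℤ f k ⟩
  f k                                        ≡⟨ q^-⊛-+ e f k ⟨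
  (q^ e ⊛ f) (e ℕ.+ k)                       ≡⟨ fromSeries-fromℤ (q^ e ⊛ f) (e ℕ.+ k) ⟨
  fromSeries (q^ e ⊛ f) (fromℤ (+ (e ℕ.+ k))) ≡⟨ cong (fromSeries (q^ e ⊛ f)) r≡e+k ⟨
  fromSeries (q^ e ⊛ f) r                    ∎
  where
  open ≡-Reasoning
  r≡e+k : r ≡ fromℤ (+ (e ℕ.+ k))
  r≡e+k = trans (-+-cancel r (fromℤ (+ e))) (trans (cong (fromℤ (+ e) ℚ.+_) r-e≡k)
                                                 (sym (fromℤ-+ (+ e) (+ k))))
... | inj₂ r-e≁ = trans (r-e≁ f) (sym (vanish (natural? r)))
  where
  -- The exponent r itself may be a natural number n. If n < e the product has no such term; if n =
  -- e + k, then r - e = k and the assumption on r - e gives `f k` = 0.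
  vanish : (∃[ n ] r ≡ fromℤ (+ n)) ⊎ (∀ f → fromSeries f r ≡ 0ℤ) → fromSeries (q^ e ⊛ f) r ≡ 0ℤ
  vanish (inj₂ r≁)       = r≁ (q^ e ⊛ f)
  vanish (inj₁ (n , r≡n)) = trans (cong (fromSeries (q^ e ⊛ f)) r≡n)
                                  (trans (fromSeries-fromℤ (q^ e ⊛ f) n) (at-n (e ℕ.≤? n)))
    where
    at-n : _ → (q^ e ⊛ f) n ≡ 0ℤ
    at-n (no  e≰n) = q^-⊛-< e f (ℕ.≰⇒> e≰n)
    at-n (yes e≤n) with ℕ.m≤n⇒∃[o]m+o≡n e≤n
    ... | k , refl = trans (q^-⊛-+ e f k) (trans (sym (fromSeries-fromℤ f k))
      (trans (cong (fromSeries f) (trans (sym (+-∸-cancel k e)) (cong (ℚ._- fromℤ (+ e)) (sym r≡n)))) (r-e≁ f)))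

-- Comparison with `G` and conclusion.

summand≡ : ∀ l j r → summand (+ l) (+ suc (suc l)) (+ 5 / 1) (+ 5 / 2) 6 j r ≡
                     -1ℤ ℤ.^ ℤ.∣ j ∣ ℤ.* fromSeries (shifted-C (suc l) (index j)) r
summand≡ l j r = cong (-1ℤ ℤ.^ ℤ.∣ j ∣ ℤ.*_) (begin
  fromSeries f (r ℚ.- exponent (+ 5 / 1) (+ 5 / 2) 6 j)    ≡⟨ cong (λ e → fromSeries f (r ℚ.- e)) (exponent-tri j) ⟩
  fromSeries f (r ℚ.- fromℤ (+ (5 ℕ.* tri (index j))))     ≡⟨ fromSeries-q^ (5 ℕ.* tri (index j)) f r ⟩
  fromSeries (q^ (5 ℕ.* tri (index j)) ⊛ f) r              ≡⟨ fromSeries-cong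
                                                                (𝕊.*-congˡ {q^ (5 ℕ.* tri (index j))} (qbinom-C l j)) r ⟩
  fromSeries (shifted-C (suc l) (index j)) r                ∎)
  where
  open ≡-Reasoning
  f = qbinom (+ l ℤ.+ + suc (suc l)) (+ l ℤ.- + 6 ℤ.* j)

sumℤ-zero : ∀ B {t} → (∀ j → t j ≡ 0ℤ) → sumℤ B t ≡ 0ℤ
sumℤ-zero B eq = trans (sumℤ-cong B eq) (trans (ℤ.+-identityˡ _) (ℤ-Sum.sum-replicate-zero B))

-- The range of j from -B to B, with B = 2L, corresponds to m ≤ 3B.
G≡total : ∀ l r → G (+ l) (+ suc (suc l)) (+ 5 / 1) (+ 5 / 2) 6 r ≡
                  fromSeries (total (suc l) ((l ℕ.+ suc (suc l)) ℕ.* 3)) r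
G≡total l r = trans (sumℤ-cong B (λ j → summand≡ l j r)) (sum (natural? r))
  where
  B = l ℕ.+ suc (suc l)
  t : ℤ → ℤ
  t j = -1ℤ ℤ.^ ℤ.∣ j ∣ ℤ.* fromSeries (shifted-C (suc l) (index j)) r
  sum : (∃[ n ] r ≡ fromℤ (+ n)) ⊎ (∀ f → fromSeries f r ≡ 0ℤ) →
        sumℤ B t ≡ fromSeries (total (suc l) (B ℕ.* 3)) r
  sum (inj₂ r≁) = trans (sumℤ-zero B (λ j → trans
                          (cong (-1ℤ ℤ.^ ℤ.∣ j ∣ ℤ.*_) (r≁ (shifted-C (suc l) (index j))))
                          (ℤ.*-zeroʳ (-1ℤ ℤ.^ ℤ.∣ j ∣))))
                        (sym (r≁ _))
  sum (inj₁ (n , refl)) = trans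
    (sumℤ-cong B (λ j → cong (-1ℤ ℤ.^ ℤ.∣ j ∣ ℤ.*_) (fromSeries-fromℤ (shifted-C (suc l) (index j)) n)))
    (trans (sym (total-sumℤ (suc l) B n)) (sym (fromSeries-fromℤ (total (suc l) (B ℕ.* 3)) n)))

fromSeries-≥0 : ∀ {f P} → Good f → (∀ r → P r ≡ fromSeries f r) → P ≥0
fromSeries-≥0 {f} {P} (f≥0 , d , f≡0) P≡f = (d , support) , nonneg
  where
  support : ∀ r → P r ≢ 0ℤ → ∃[ n ] n ℕ.≤ d × r ≡ fromℤ (+ n)
  support r Pr≢0 with natural? r
  ... | inj₂ r≁ = contradiction (trans (P≡f r) (r≁ f)) Pr≢0
  ... | inj₁ (n , refl) with n ℕ.≤? d
  ...   | yes n≤d = n , n≤d , refl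
  ...   | no  n≰d = contradiction (trans (P≡f r) (trans (fromSeries-fromℤ f n) (f≡0 n (ℕ.≰⇒> n≰d)))) Pr≢0

  nonneg : ∀ r → 0ℤ ℤ.≤ P r
  nonneg r = ≡.subst (0ℤ ℤ.≤_) (sym (P≡f r)) (at r)
    where
    at : ∀ r → 0ℤ ℤ.≤ fromSeries f r
    at (mkℚ (+ n)    zero    _) = f≥0 n
    at (mkℚ (+ n)    (suc _) _) = ℤ.≤-refl
    at (mkℚ -[1+ n ] _       _) = ℤ.≤-refl

open import Data.Integer.Base using (_+_; _-_; _≤_)

mainTheorem14 : (L : ℤ) → 1ℤ ≤ L → G (L - 1ℤ) (L + 1ℤ) (+ 5 / 1) (+ 5 / 2) 6 ≥0
-- With L = l + 1 the first argument computes to l, whereas L + 1 has to be rewritten as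
-- `suc (suc l)`.
mainTheorem14 (+ suc l) _ = ≡.subst (λ M → G (+ l) M (+ 5 / 1) (+ 5 / 2) 6 ≥0)
  (cong +_ (ℕ.+-comm 1 (suc l)))
  (fromSeries-≥0 (Good-total (suc l) _ L≤) (G≡total l))
  where
  L≤ : suc l ℕ.≤ (l ℕ.+ suc (suc l)) ℕ.* 3
  L≤ = ℕ.≤-trans (ℕ.≤-trans (ℕ.n≤1+n _) (ℕ.m≤n+m (suc (suc l)) l)) (ℕ.m≤m*n _ 3)
mainTheorem14 (+ zero) (ℤ.+≤+ ())
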